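{- Let $\ell$ be a prime, $p\ne\ell$ a prime and $n\ge1$. Write $p^n-1=\ell^{\lambda^- }\omega^-$ and $p^n+1=\ell^{\lambda^+}\omega^+$ with $\gcd(\ell,\omega^\pm)=1$. Let $\lambda_m=\max\{\lambda^-,\lambda^+\}$ and, if $\lambda_m>0$, let $\omega_m$ be the integer with $\ell^{\lambda_m}\omega_m\in\{p^n-1,p^n+1\}$. (1) If $\ell$ is odd, the number of elements of $\mathbb{F}_{p^n}$ of preperiod $0$ (under $T_\ell$) is $(\omega^-+\omega^+)/2$, and for $1\le k\le\lambda_m$ the number of elements of preperiod $k$ is $(\ell-1)\ell^{k-1}\omega_m/2$. (2) If $\ell=2$, the number of elements of $\mathbb{F}_{p^n}$ of preperiod $0$ is $(\omega^-+\omega^+)/2$, the number of preperiod $1$ is $(\omega^-+\omega^+)/2$, and for $2\le k\le\lambda_m$ the number of preperiod $k$ is $2^{k-2}\omega_m$.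
   Context: $T_\ell\in\mathbb{Z}[x]$ is the Chebyshev polynomial of the first kind of degree $\ell$, defined by $T_\ell(z+z^{ -1})=z^\ell+z^{ -\ell}$, acting on $\mathbb{F}_{p^n}$ by reduction mod $p$. An element $a$ has preperiod $\rho$ under $T_\ell$ if $\rho\ge0,\pi\ge1$ are minimal integers with $T_\ell^{\rho+\pi}(a)=T_\ell^\rho(a)$ ($T_\ell^j$ the $j$-th iterate). -}

module Defs where

open import Level using (Level)
open import Data.Nat using (ℕ; zero; suc; _<_; _≤_)
open import Data.Nat.Properties using ()
open import Data.Product using (Σ; ∃; _×_; _,_)
open import Data.List using (List; length)
open import Data.List.Relation.Unary.Unique.Propositional using (Unique)
open import Data.List.Membership.Propositional using (_∈_)
open import Function.Bundles using (_⇔_; _↔_)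
open import Data.Fin using (Fin)
open import Relation.Nullary using (¬_)
open import Relation.Binary.PropositionalEquality using (_≡_)
open import Algebra.Bundles using (CommutativeRing)

IsField : ∀ {c ℓ} → CommutativeRing c ℓ → Set _
IsField R = ¬ (1# ≈ 0#) × (∀ x → ¬ (x ≈ 0#) → ∃ λ y → (x * y) ≈ 1#)
  where open CommutativeRing R

record IsFiniteFieldOfOrder {c ℓ} (R : CommutativeRing c ℓ) (q : ℕ) : Set (Level._⊔_ c ℓ) where
  open CommutativeRing R
  field
    isField   : IsField R
    ≈⇒≡       : ∀ {x y} → x ≈ y → x ≡ y
    ≡⇒≈       : ∀ {x y} → x ≡ y → x ≈ y
    card      : Carrier ↔ Fin q

module Chebyshev {c ℓ} (R : CommutativeRing c ℓ) where
  open CommutativeRing R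

  -- Chebyshev polynomial of the first kind evaluated in R, via the standard
  -- recurrence T₀ = 2, T₁ = x, T_{k+2} = x T_{k+1} - T_k (the unique integer
  -- polynomials with T_k(z + z⁻¹) = z^k + z^{-k}), reduced into R.
  T : ℕ → Carrier → Carrier
  T zero x = 1# + 1#
  T (suc zero) x = x
  T (suc (suc k)) x = (x * T (suc k) x) - T k x

  iter : (Carrier → Carrier) → ℕ → Carrier → Carrier
  iter f zero a = a
  iter f (suc j) a = f (iter f j a)

  PeriodicAfter : ℕ → Carrier → ℕ → Set c
  PeriodicAfter l a ρ = ∃ λ π → 1 ≤ π × iter (T l) (ρ Data.Nat.+ π) a ≡ iter (T l) ρ a

  HasPreperiod : ℕ → Carrier → ℕ → Set c
  HasPreperiod l a ρ = PeriodicAfter l a ρ × (∀ ρ' → ρ' < ρ → ¬ PeriodicAfter l a ρ')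

  CountPreperiod : ℕ → ℕ → ℕ → Set c
  CountPreperiod l k N = Σ (List Carrier) λ L →
    Unique L × (∀ a → (a ∈ L) ⇔ HasPreperiod l a k) × length L ≡ N

{-# OPTIONS --safe #-}

-- Write a = z + z⁻¹, so that T_m(a) = z^m + z^(-m), and let τ(i) = T_|i|(a) for i ∈ ℤ. From
-- (τ(i) − τ(j))² = (τ(i+j) − 2)(τ(i−j) − 2) one gets, over a field, τ(i) = τ(j) iff i + j or i − j is
-- a "period" D of a, i.e. τ(D) = 2; the periods form an ideal of ℤ. In characteristic p the Frobenius
-- map of F[z]/(z² − az + 1) gives T_p(a) = a^p, hence T_q(a) = a for q = p^n, so that q − 1 or q + 1 is
-- a period of every a. Therefore a has preperiod at most k iff A_k = l^min(k,λ⁻) ω⁻ or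
-- B_k = l^min(k,λ⁺) ω⁺ is a period, i.e. iff a is a zero of T_i − T_j, where i + j = A_k and
-- i − j = B_k. This polynomial is monic of degree i = (A_k + B_k) / 2, and it divides T_q − T_1, which
-- vanishes on the whole field and has degree q; so it has exactly (A_k + B_k) / 2 zeros.
module Submission where

open import Defs
import Level
open import Data.Nat as ℕ
  using (ℕ; zero; suc; _≤_; _<_; s≤s; z≤n; _∸_; _⊓_; _⊔_; _%_; _/_; _!; NonZero)
import Data.Nat.Properties as ℕₚ
open import Data.Nat.Combinatorics using (_C_; nCk≡n!/k![n-k]!; k![n∸k]!∣n!; nCn≡1)
open import Data.Nat.Coprimality as Coprimality using (Coprime; coprime-divisor)
open import Data.Nat.Divisibility
  using (_∣_; _∤_; divides; ∣⇒≤; ∣1⇒≡1; ∣-trans; m∣m*n; *-monoʳ-∣; *-pres-∣; ∣m+n∣m⇒∣n)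
open import Data.Nat.DivMod using (m/n*n≡m; m≡m%n+[m/n]*n; m%n<n)
open import Data.Nat.GCD
  using (gcd; gcd-GCD; gcd-greatest; gcd[m,n]∣m; gcd[m,n]∣n; c*gcd[m,n]≡gcd[cm,cn]; module Bézout)
open import Data.Nat.Primality
  using (Prime; euclidsLemma; prime[2]; prime⇒irreducible; prime⇒nonTrivial; prime⇒nonZero)
open import Data.Integer as ℤ using (ℤ; +_; -[1+_]; ∣_∣; _⊖_)
import Data.Integer.Properties as ℤₚ
import Data.Integer.Tactic.RingSolver as ℤ-Solver
open import Data.Fin as Fin using (Fin; toℕ; fromℕ; fromℕ<)
import Data.Fin.Properties as Finₚ
open import Data.Fin.Permutation using (permutation)
open import Data.List as List using (List; []; _∷_; length; filter)
open import Data.List.Properties using (length-tabulate; filter-all)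
open import Data.List.Membership.Propositional using (_∈_)
open import Data.List.Membership.Propositional.Properties using (∈-tabulate⁺; ∈-filter⁺; ∈-filter⁻)
open import Data.List.Relation.Unary.All as All using (All; []; _∷_)
open import Data.List.Relation.Unary.All.Properties using (all-filter)
open import Data.List.Relation.Unary.AllPairs using ([]; _∷_)
open import Data.List.Relation.Unary.Unique.Propositional using (Unique)
open import Data.List.Relation.Unary.Unique.Propositional.Properties using (tabulate⁺; filter⁺)
open import Data.Maybe using (Maybe; just; nothing)
open import Data.Product using (Σ; ∃; _×_; _,_; proj₁; proj₂)
open import Data.Sum as Sum using (_⊎_; inj₁; inj₂; [_,_]′)
open import Data.Vec.Functional using (init; last; tail; replicate)
open import Function using (_∘_; id)
open import Function.Bundles using (Inverse; Equivalence; _⇔_; mk⇔)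
open import Relation.Nullary using (¬_; Dec; yes; no; contradiction; ¬?)
import Relation.Nullary.Decidable as Dec
open import Relation.Binary.PropositionalEquality as ≡ using (_≡_)
open import Algebra.Bundles using (CommutativeRing; CommutativeSemiring; CommutativeMonoid)
import Algebra.Properties.CommutativeMonoid.Sum
open import Algebra.Properties.CommutativeSemigroup ℕₚ.+-commutativeSemigroup using (xy∙z≈xz∙y)
open import Algebra.Solver.Ring.AlmostCommutativeRing
  using (fromCommutativeRing; _-Raw-AlmostCommutative⟶_)
open import Algebra.Structures.Biased using (isCommutativeSemiringˡ)

-- A period is defined by τ(D) = 2 instead of z^D = 1 because z need not lie in F. What does lie in
-- F is τ(D) - 2 = z^(-D) (z^D - 1)², which is why τ(i) - τ(j) enters squared. Counting zeros by
-- degree replaces counting the fibres of z ↦ z + z⁻¹, with its exceptional points z = ±1.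
--
-- The obstacle is parity: integers i, j with i + j = A and i - j = B exist only if A and B have the
-- same parity. For odd l this survives the removal of factors l from A and from B one at a time.
-- For l = 2 both q - 1 and q + 1 are even, and factors 2 can be removed one at a time only while A
-- and B stay even; the last step, to ω⁻ and ω⁺, has to halve both at once.
--
-- The difference (q + 1) - (q - 1) = 2 shapes the counts: if l^r does not divide 2, then l^r
-- divides at most one of q ± 1, so from level r on only one of A_k, B_k grows. For odd l this
-- begins at r = 1, for l = 2 at r = 2, hence the separate formula for preperiod 1.

-- Ring solver with integer coefficients

module IntegerCoefficients {c ℓ} (R : CommutativeRing c ℓ) where
  open CommutativeRing R
  open import Algebra.Properties.Ring ring
  open import Algebra.Properties.AbelianGroup +-abelianGroup
  open import Algebra.Properties.CommutativeSemigroup +-commutativeSemigroup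
    using (interchange)
  open import Algebra.Properties.Semiring.Mult.TCOptimised semiring
    using (1+×; ×-homo-+; ×1-homo-*) renaming (_×_ to _·_)
  open import Relation.Binary.Reasoning.Setoid setoid

  -- With the optimised multiple `_·_` the images of 0 and 1 are `0#` and `1#` by definition, so
  -- `con (+ 0)` and `con (+ 1)` match goals written with these constants.
  fromℤ : ℤ → Carrier
  fromℤ (+ n)    = n · 1#
  fromℤ -[1+ n ] = - (suc n · 1#)

  fromℤ-neg : ∀ i → fromℤ (ℤ.- i) ≈ - fromℤ i
  fromℤ-neg (+ zero)    = sym ε⁻¹≈ε
  fromℤ-neg (+ (suc n)) = refl
  fromℤ-neg -[1+ n ]    = sym (⁻¹-involutive _)

  fromℤ-⊖ : ∀ m n → fromℤ (m ⊖ n) ≈ m · 1# - n · 1#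
  fromℤ-⊖ m zero = sym (trans (+-congˡ ε⁻¹≈ε) (+-identityʳ _))
  fromℤ-⊖ zero (suc n) = sym (+-identityˡ _)
  fromℤ-⊖ (suc m) (suc n) = begin
    fromℤ (suc m ⊖ suc n)              ≡⟨ ≡.cong fromℤ (ℤₚ.[1+m]⊖[1+n]≡m⊖n m n) ⟩
    fromℤ (m ⊖ n)                      ≈⟨ fromℤ-⊖ m n ⟩
    m · 1# - n · 1#                    ≈⟨ +-identityˡ _ ⟨
    0# + (m · 1# - n · 1#)             ≈⟨ +-congʳ (-‿inverseʳ 1#) ⟨
    (1# - 1#) + (m · 1# - n · 1#)      ≈⟨ interchange 1# (- 1#) (m · 1#) (- (n · 1#)) ⟩
    (1# + m · 1#) + (- 1# - n · 1#)    ≈⟨ +-congˡ (⁻¹-∙-comm 1# (n · 1#)) ⟩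
    (1# + m · 1#) - (1# + n · 1#)      ≈⟨ +-cong (1+× m 1#) (-‿cong (1+× n 1#)) ⟨
    suc m · 1# - suc n · 1#            ∎

  fromℤ-+ : ∀ i j → fromℤ (i ℤ.+ j) ≈ fromℤ i + fromℤ j
  fromℤ-+ (+ m)    (+ n)    = ×-homo-+ 1# m n
  fromℤ-+ (+ m)    -[1+ n ] = fromℤ-⊖ m (suc n)
  fromℤ-+ -[1+ m ] (+ n)    = trans (fromℤ-⊖ n (suc m)) (+-comm _ _)
  fromℤ-+ -[1+ m ] -[1+ n ] = begin
    - (suc (suc (m ℕ.+ n)) · 1#)        ≡⟨ ≡.cong (λ k → - (suc k · 1#)) (ℕₚ.+-suc m n) ⟨
    - ((suc m ℕ.+ suc n) · 1#)          ≈⟨ -‿cong (×-homo-+ 1# (suc m) (suc n)) ⟩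
    - (suc m · 1# + suc n · 1#)         ≈⟨ ⁻¹-∙-comm _ _ ⟨
    - (suc m · 1#) - (suc n · 1#)       ∎

  private
    fromℤ-+* : ∀ m j → fromℤ (+ m ℤ.* j) ≈ m · 1# * fromℤ j
    fromℤ-+* m (+ n) = trans (reflexive (≡.cong fromℤ (≡.sym (ℤₚ.pos-* m n)))) (×1-homo-* m n)
    fromℤ-+* m -[1+ n ] = begin
      fromℤ (+ m ℤ.* -[1+ n ])         ≡⟨ ≡.cong fromℤ (≡.sym (ℤₚ.neg-distribʳ-* (+ m) (+ suc n))) ⟩
      fromℤ (ℤ.- (+ m ℤ.* + suc n))    ≈⟨ fromℤ-neg (+ m ℤ.* + suc n) ⟩
      - fromℤ (+ m ℤ.* + suc n)        ≈⟨ -‿cong (fromℤ-+* m (+ suc n)) ⟩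
      - (m · 1# * suc n · 1#)          ≈⟨ -‿distribʳ-* _ _ ⟩
      m · 1# * - (suc n · 1#)          ∎

  fromℤ-* : ∀ i j → fromℤ (i ℤ.* j) ≈ fromℤ i * fromℤ j
  fromℤ-* (+ m) j = fromℤ-+* m j
  fromℤ-* -[1+ m ] j = begin
    fromℤ (-[1+ m ] ℤ.* j)         ≡⟨ ≡.cong fromℤ (≡.sym (ℤₚ.neg-distribˡ-* (+ suc m) j)) ⟩
    fromℤ (ℤ.- (+ suc m ℤ.* j))    ≈⟨ fromℤ-neg (+ suc m ℤ.* j) ⟩
    - fromℤ (+ suc m ℤ.* j)        ≈⟨ -‿cong (fromℤ-+* (suc m) j) ⟩
    - (suc m · 1# * fromℤ j)       ≈⟨ -‿distribˡ-* _ _ ⟩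
    - (suc m · 1#) * fromℤ j       ∎

  morphism : CommutativeRing.rawRing ℤₚ.+-*-commutativeRing
             -Raw-AlmostCommutative⟶ fromCommutativeRing R
  morphism = record
    { ⟦_⟧ = fromℤ ; +-homo = fromℤ-+ ; *-homo = fromℤ-* ; -‿homo = fromℤ-neg
    ; 0-homo = refl ; 1-homo = refl }

  -- A semi-decision is enough for the solver: equality in R need not be decidable, so coefficients
  -- are identified only if they are equal as integers.
  coefficient≟ : ∀ i j → Maybe (fromℤ i ≈ fromℤ j)
  coefficient≟ i j with i ℤₚ.≟ j
  ... | yes i≡j = just (reflexive (≡.cong fromℤ i≡j))
  ... | no  _   = nothing

  open import Algebra.Solver.Ring
    (CommutativeRing.rawRing ℤₚ.+-*-commutativeRing) (fromCommutativeRing R) morphism coefficient≟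
    public using (solve; _:=_; _:+_; _:*_; _:-_; :-_; con)

-- Chebyshev identities over integer indices

module ChebyshevIdentities {c ℓ} (R : CommutativeRing c ℓ) where
  open CommutativeRing R
  open Chebyshev R using (T)
  open IntegerCoefficients R
  open import Relation.Binary.Reasoning.Setoid setoid

  T-cong : ∀ n {x y} → x ≈ y → T n x ≈ T n y
  T-cong zero          x≈y = refl
  T-cong (suc zero)    x≈y = x≈y
  T-cong (suc (suc n)) x≈y =
    +-cong (*-cong x≈y (T-cong (suc n) x≈y)) (-‿cong (T-cong n x≈y))

  module _ (a : Carrier) where

    τ : ℤ → Carrier
    τ i = T ∣ i ∣ a

    τ-≡ : ∀ {i j} → i ≡ j → τ i ≈ τ j
    τ-≡ i≡j = reflexive (≡.cong τ i≡j)

    τ-neg : ∀ i → τ (ℤ.- i) ≈ τ i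
    τ-neg i = reflexive (≡.cong (λ n → T n a) (ℤₚ.∣-i∣≡∣i∣ i))

    -- The case m = 1 of the product formula `product-ℕ`; evenness of τ makes it hold at negative
    -- indices too.
    τ-recurrence : ∀ i → a * τ i ≈ τ (+ 1 ℤ.+ i) + τ (+ 1 ℤ.- i)
    τ-recurrence (+ zero) = solve 1 (λ x → x :* (con (+ 1) :+ con (+ 1)) := x :+ x) refl a
    τ-recurrence (+ suc n) = begin
      a * T (suc n) a                                  ≈⟨ solve 2 (λ x y → x := (x :- y) :+ y) refl _ _ ⟩
      T (suc (suc n)) a + T n a
        ≈⟨ +-congˡ (sym (trans (τ-≡ (index n)) (τ-neg (+ n)))) ⟩
      T (suc (suc n)) a + τ (+ 1 ℤ.- + suc n)          ∎
      where
      index : ∀ n → + 1 ℤ.- + suc n ≡ ℤ.- + n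
      index zero    = ≡.refl
      index (suc n) = ≡.refl
    τ-recurrence -[1+ zero ] =
      solve 1 (λ x → x :* x := con (+ 1) :+ con (+ 1) :+ (x :* x :- (con (+ 1) :+ con (+ 1)))) refl a
    τ-recurrence -[1+ suc n ] = solve 3 (λ x y z → x :* y := z :+ (x :* y :- z)) refl a _ _

    private
      -- As functions of m both sides obey the recurrence of `T`, so two-step induction on m
      -- applies; `shift` is that recurrence for the right-hand side.
      product-ℕ : ∀ m i → τ (+ m) * τ i ≈ τ (+ m ℤ.+ i) + τ (+ m ℤ.- i)
      product-ℕ zero i = begin
        (1# + 1#) * τ i ≈⟨ solve 1 (λ x → (con (+ 1) :+ con (+ 1)) :* x := x :+ x) refl (τ i) ⟩
        τ i + τ i       ≈⟨ +-cong (τ-≡ (≡.sym (ℤₚ.+-identityˡ i)))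
                                  (sym (trans (τ-≡ (ℤₚ.+-identityˡ (ℤ.- i))) (τ-neg i))) ⟩
        τ (+ 0 ℤ.+ i) + τ (+ 0 ℤ.- i) ∎
      product-ℕ (suc zero) i = τ-recurrence i
      product-ℕ (suc (suc m)) i = begin
        (a * u₁ - u₀) * τ i
          ≈⟨ solve 4 (λ x y z w → (x :* y :- z) :* w := x :* (y :* w) :- z :* w) refl a u₁ u₀ (τ i) ⟩
        a * (u₁ * τ i) - u₀ * τ i
          ≈⟨ +-cong (*-congˡ (product-ℕ (suc m) i)) (-‿cong (product-ℕ m i)) ⟩
        a * (τ (+ suc m ℤ.+ i) + τ (+ suc m ℤ.- i)) - (τ (+ m ℤ.+ i) + τ (+ m ℤ.- i))
          ≈⟨ solve 5 (λ x y z v w → x :* (y :+ z) :- (v :+ w) := (x :* y :- v) :+ (x :* z :- w)) refl _ _ _ _ _ ⟩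
        (a * τ (+ suc m ℤ.+ i) - τ (+ m ℤ.+ i)) + (a * τ (+ suc m ℤ.- i) - τ (+ m ℤ.- i))
          ≈⟨ +-cong (shift i) (shift (ℤ.- i)) ⟩
        τ (+ suc (suc m) ℤ.+ i) + τ (+ suc (suc m) ℤ.- i) ∎
        where
        u₁ = τ (+ suc m)
        u₀ = τ (+ m)
        shift : ∀ j → a * τ (+ suc m ℤ.+ j) - τ (+ m ℤ.+ j) ≈ τ (+ suc (suc m) ℤ.+ j)
        shift j = begin
          a * τ (+ suc m ℤ.+ j) - τ (+ m ℤ.+ j)
            ≈⟨ +-congʳ (τ-recurrence (+ suc m ℤ.+ j)) ⟩
          τ (+ 1 ℤ.+ (+ suc m ℤ.+ j)) + τ (+ 1 ℤ.- (+ suc m ℤ.+ j)) - τ (+ m ℤ.+ j)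
            ≈⟨ +-congʳ (+-cong (τ-≡ (≡.sym (ℤₚ.+-assoc (+ 1) (+ suc m) j)))
                               (trans (τ-≡ (reflect (+ m) j)) (τ-neg (+ m ℤ.+ j)))) ⟩
          τ (+ suc (suc m) ℤ.+ j) + τ (+ m ℤ.+ j) - τ (+ m ℤ.+ j)
            ≈⟨ solve 2 (λ x y → x :+ y :- y := x) refl _ _ ⟩
          τ (+ suc (suc m) ℤ.+ j) ∎
          where
          reflect : ∀ k j → + 1 ℤ.- ((+ 1 ℤ.+ k) ℤ.+ j) ≡ ℤ.- (k ℤ.+ j)
          reflect = ℤ-Solver.solve-∀

    τ-product : ∀ i j → τ i * τ j ≈ τ (i ℤ.+ j) + τ (i ℤ.- j)
    τ-product (+ m) j = product-ℕ m j
    -- Evenness of τ reduces this to `suc m`, with the two summands exchanged.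
    τ-product -[1+ m ] j = begin
      τ (+ suc m) * τ j                           ≈⟨ product-ℕ (suc m) j ⟩
      τ (+ suc m ℤ.+ j) + τ (+ suc m ℤ.- j)       ≈⟨ +-comm _ _ ⟩
      τ (+ suc m ℤ.- j) + τ (+ suc m ℤ.+ j)
        ≈⟨ +-cong (flip (e₁ (+ suc m) j)) (flip (e₂ (+ suc m) j)) ⟩
      τ (-[1+ m ] ℤ.+ j) + τ (-[1+ m ] ℤ.- j)     ∎
      where
      flip : ∀ {i j} → i ≡ ℤ.- j → τ i ≈ τ j
      flip {j = j} i≡-j = trans (τ-≡ i≡-j) (τ-neg j)
      e₁ : ∀ i j → i ℤ.- j ≡ ℤ.- (ℤ.- i ℤ.+ j)
      e₁ = ℤ-Solver.solve-∀
      e₂ : ∀ i j → i ℤ.+ j ≡ ℤ.- (ℤ.- i ℤ.- j)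
      e₂ = ℤ-Solver.solve-∀

    τ-double : ∀ i → τ (i ℤ.+ i) ≈ τ i * τ i - (1# + 1#)
    τ-double i = begin
      τ (i ℤ.+ i)                             ≈⟨ solve 1 (λ x → x := x :+ two :- two) refl _ ⟩
      τ (i ℤ.+ i) + (1# + 1#) - (1# + 1#)     ≈⟨ +-congʳ (+-congˡ (τ-≡ (ℤₚ.+-inverseʳ i))) ⟨
      τ (i ℤ.+ i) + τ (i ℤ.- i) - (1# + 1#)   ≈⟨ +-congʳ (τ-product i i) ⟨
      τ i * τ i - (1# + 1#)                   ∎
      where
      two = con (+ 1) :+ con (+ 1)

    -- With a = z + z⁻¹, both sides are z⁻²ⁱ (zⁱ⁺ʲ − 1)² (zⁱ⁻ʲ − 1)².
    τ-difference² : ∀ i j → (τ i - τ j) * (τ i - τ j) ≈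
                            (τ (i ℤ.+ j) - (1# + 1#)) * (τ (i ℤ.- j) - (1# + 1#))
    τ-difference² i j = begin
      (τ i - τ j) * (τ i - τ j)
        ≈⟨ solve 2 (λ x y → (x :- y) :* (x :- y) :=
             ((x :* x :- two) :+ (y :* y :- two)) :- two :* (x :* y) :+ two :* two) refl (τ i) (τ j) ⟩
      ((τ i * τ i - 2#) + (τ j * τ j - 2#)) - 2# * (τ i * τ j) + 2# * 2#
        ≈⟨ +-congʳ (+-cong (+-cong (τ-double i) (τ-double j)) (-‿cong (*-congˡ (sym (τ-product i j))))) ⟨
      (τ (i ℤ.+ i) + τ (j ℤ.+ j)) - 2# * (p + m) + 2# * 2#
        ≈⟨ +-congʳ (+-congʳ (trans (τ-product (i ℤ.+ j) (i ℤ.- j)) (+-cong (τ-≡ (e₁ i j)) (τ-≡ (e₂ i j))))) ⟨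
      p * m - 2# * (p + m) + 2# * 2#
        ≈⟨ solve 2 (λ x y → x :* y :- two :* (x :+ y) :+ two :* two := (x :- two) :* (y :- two)) refl p m ⟩
      (p - 2#) * (m - 2#) ∎
      where
      two = con (+ 1) :+ con (+ 1)
      2# = 1# + 1#
      p = τ (i ℤ.+ j)
      m = τ (i ℤ.- j)
      e₁ : ∀ i j → (i ℤ.+ j) ℤ.+ (i ℤ.- j) ≡ i ℤ.+ i
      e₁ = ℤ-Solver.solve-∀
      e₂ : ∀ i j → (i ℤ.+ j) ℤ.- (i ℤ.- j) ≡ j ℤ.+ j
      e₂ = ℤ-Solver.solve-∀

  -- By the product formula T_n · T_((m+1)n) = T_((m+2)n) + T_(mn), which is the recurrence of `T`
  -- at the argument T_n(x).
  T-compose : ∀ m n x → T m (T n x) ≈ T (m ℕ.* n) x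
  T-compose zero n x = refl
  T-compose (suc zero) n x = reflexive (≡.cong (λ k → T k x) (≡.sym (ℕₚ.*-identityˡ n)))
  T-compose (suc (suc m)) n x = begin
    T n x * T (suc m) (T n x) - T m (T n x)
      ≈⟨ +-cong (*-congˡ (T-compose (suc m) n x)) (-‿cong (T-compose m n x)) ⟩
    T n x * T (suc m ℕ.* n) x - T (m ℕ.* n) x
      ≈⟨ +-cong (τ-product x (+ n) (+ (suc m ℕ.* n))) refl ⟩
    T (suc (suc m) ℕ.* n) x + τ x (+ n ℤ.- + (suc m ℕ.* n)) - T (m ℕ.* n) x
      ≈⟨ +-congʳ (+-congˡ (trans (τ-≡ x (e (+ n) (+ (m ℕ.* n)))) (τ-neg x (+ (m ℕ.* n))))) ⟩
    T (suc (suc m) ℕ.* n) x + T (m ℕ.* n) x - T (m ℕ.* n) x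
      ≈⟨ solve 2 (λ x y → x :+ y :- y := x) refl _ _ ⟩
    T (suc (suc m) ℕ.* n) x ∎
    where
    e : ∀ i j → i ℤ.- (i ℤ.+ j) ≡ ℤ.- j
    e = ℤ-Solver.solve-∀

-- Frobenius in characteristic p and the quadratic ring

prime∤factorial : ∀ {p} → Prime p → ∀ m → m < p → p ∤ m !
prime∤factorial p-prime zero m<p p∣1 =
  ℕₚ.<⇒≢ (ℕ.nonTrivial⇒n>1 _ {{prime⇒nonTrivial p-prime}}) (≡.sym (∣1⇒≡1 p∣1))
prime∤factorial p-prime (suc m) m<p p∣m! with euclidsLemma (suc m) (m !) p-prime p∣m!
... | inj₁ p∣1+m = ℕₚ.<⇒≱ m<p (∣⇒≤ p∣1+m)
... | inj₂ p∣m!′ = prime∤factorial p-prime m (ℕₚ.<-trans (ℕₚ.n<1+n m) m<p) p∣m!′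

-- The prime p divides p! = C(p,k) · k! (p - k)!, but neither k! nor (p - k)!, whose factors are all
-- below p.
prime∣binomial : ∀ {p k} → Prime p → 0 < k → k < p → p ∣ (p C k)
prime∣binomial {suc p-1} {k} p-prime 0<k k<p =
  [ (λ p∣C → p∣C)
  , (λ p∣k![p∸k]! → contradiction (euclidsLemma (k !) ((p ℕ.∸ k) !) p-prime p∣k![p∸k]!)
       [ prime∤factorial p-prime k k<p
       , prime∤factorial p-prime (p ℕ.∸ k) (ℕₚ.∸-monoʳ-< 0<k k≤p) ]′)
  ]′ (euclidsLemma (p C k) (k ! ℕ.* (p ℕ.∸ k) !) p-prime
      (≡.subst (p ∣_) (≡.sym factorial≡) (m∣m*n (p-1 !))))
  where
  p = suc p-1
  k≤p = ℕₚ.<⇒≤ k<p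
  instance
    nonZero : NonZero (k ! ℕ.* (p ℕ.∸ k) !)
    nonZero = k ℕₚ.!* (p ℕ.∸ k) !≢0
  factorial≡ : (p C k) ℕ.* (k ! ℕ.* (p ℕ.∸ k) !) ≡ p !
  factorial≡ = ≡.trans (≡.cong (ℕ._* (k ! ℕ.* (p ℕ.∸ k) !)) (nCk≡n!/k![n-k]! k≤p)) (m/n*n≡m (k![n∸k]!∣n! k≤p))

module Frobenius {c ℓ} (S : CommutativeSemiring c ℓ) where
  open CommutativeSemiring S
  open import Algebra.Properties.Semiring.Mult semiring renaming (_×_ to _·_)
  open import Algebra.Properties.Semiring.Exp semiring
  open import Algebra.Properties.Monoid.Sum +-monoid
  open import Algebra.Properties.CommutativeSemiring.Binomial S
  open import Relation.Binary.Reasoning.Setoid setoid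

  ∣⇒·≈0 : ∀ {p m} → p · 1# ≈ 0# → p ∣ m → ∀ x → m · x ≈ 0#
  ∣⇒·≈0 {p} p·1≈0 (divides q ≡.refl) x = begin
    (q ℕ.* p) · x        ≈⟨ ×-congʳ (q ℕ.* p) (*-identityˡ x) ⟨
    (q ℕ.* p) · (1# * x) ≈⟨ ×-assoc-* (q ℕ.* p) 1# x ⟨
    (q ℕ.* p) · 1# * x   ≈⟨ *-congʳ (×1-homo-* q p) ⟩
    q · 1# * p · 1# * x  ≈⟨ *-congʳ (trans (*-congˡ p·1≈0) (zeroʳ _)) ⟩
    0# * x               ≈⟨ zeroˡ x ⟩
    0#                   ∎

  -- Only the two outer terms of the binomial expansion survive. The setting is a commutative
  -- semiring because that is the structure which `E` below is given.
  frobenius-+ : ∀ {p} → Prime p → p · 1# ≈ 0# → ∀ x y → (x + y) ^ p ≈ x ^ p + y ^ p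
  frobenius-+ {suc p-1} p-prime p·1≈0 x y = begin
    (x + y) ^ p                                   ≈⟨ theorem p x y ⟩
    sum t                                         ≈⟨ +-congˡ (sum-init-last (tail t)) ⟩
    t Fin.zero + (sum (init (tail t)) + last (tail t))
      ≈⟨ +-cong first (+-cong middle final) ⟩
    y ^ p + (0# + x ^ p)                          ≈⟨ +-congˡ (+-identityˡ _) ⟩
    y ^ p + x ^ p                                 ≈⟨ +-comm _ _ ⟩
    x ^ p + y ^ p                                 ∎
    where
    p = suc p-1
    t = binomialTerm x y p
    first : t Fin.zero ≈ y ^ p
    first = trans (×-homo-1 _) (*-identityˡ _)
    final : last (tail t) ≈ x ^ p
    final = begin
      (p C k) · (x ^ k * y ^ (p ℕ.∸ k))
        ≡⟨ ≡.cong (λ k → (p C k) · (x ^ k * y ^ (p ℕ.∸ k))) (Finₚ.toℕ-fromℕ p) ⟩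
      (p C p) · (x ^ p * y ^ (p ℕ.∸ p))  ≡⟨ ≡.cong₂ (λ i j → i · (x ^ p * y ^ j)) (nCn≡1 p) (ℕₚ.n∸n≡0 p) ⟩
      1 · (x ^ p * 1#)                   ≈⟨ trans (×-homo-1 _) (*-identityʳ _) ⟩
      x ^ p                              ∎
      where k = toℕ (fromℕ p)
    middle : sum (init (tail t)) ≈ 0#
    middle = trans (sum-cong-≋ vanish) (sum-replicate-zero p-1)
      where
      vanish : ∀ i → init (tail t) i ≈ 0#
      vanish i = ∣⇒·≈0 p·1≈0
        (prime∣binomial p-prime (s≤s z≤n)
          (s≤s (≡.subst (_< p-1) (≡.sym (Finₚ.toℕ-inject₁ i)) (Finₚ.toℕ<n i)))) _

-- The ring R[z]/(z² − az + 1), with (u , v) standing for u + vz.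
module QuadraticExtension {c ℓ} (R : CommutativeRing c ℓ) (a : CommutativeRing.Carrier R) where
  open CommutativeRing R
  open IntegerCoefficients R using (solve; _:=_; _:+_; _:*_; _:-_; :-_; con)

  E : CommutativeSemiring c ℓ
  E = record
    { Carrier = Carrier × Carrier
    ; _≈_ = λ (u , v) (u′ , v′) → u ≈ u′ × v ≈ v′
    ; _+_ = λ (u , v) (u′ , v′) → u + u′ , v + v′
    ; _*_ = λ (u , v) (u′ , v′) → u * u′ - v * v′ , u * v′ + v * u′ + a * (v * v′)
    ; 0# = 0# , 0#
    ; 1# = 1# , 0#
    ; isCommutativeSemiring = isCommutativeSemiringˡ record
      { +-isCommutativeMonoid = record
        { isMonoid = record
          { isSemigroup = record
            { isMagma = record
              { isEquivalence = record
                { refl = refl , refl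
                ; sym = λ (p , q) → sym p , sym q
                ; trans = λ (p , q) (p′ , q′) → trans p p′ , trans q q′ }
              ; ∙-cong = λ (p , q) (p′ , q′) → +-cong p p′ , +-cong q q′ }
            ; assoc = λ _ _ _ → +-assoc _ _ _ , +-assoc _ _ _ }
          ; identity = (λ _ → +-identityˡ _ , +-identityˡ _) , (λ _ → +-identityʳ _ , +-identityʳ _) }
        ; comm = λ _ _ → +-comm _ _ , +-comm _ _ }
      ; *-isCommutativeMonoid = record
        { isMonoid = record
          { isSemigroup = record
            { isMagma = record
              { isEquivalence = record
                { refl = refl , refl
                ; sym = λ (p , q) → sym p , sym q
                ; trans = λ (p , q) (p′ , q′) → trans p p′ , trans q q′ }
              ; ∙-cong = λ (p , q) (p′ , q′) →
                  +-cong (*-cong p p′) (-‿cong (*-cong q q′)) ,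
                  +-cong (+-cong (*-cong p q′) (*-cong q p′)) (*-congˡ (*-cong q q′)) }
            ; assoc = λ (u , v) (u′ , v′) (u″ , v″) →
                solve 7 (λ a u v u′ v′ u″ v″ →
                  (u :* u′ :- v :* v′) :* u″ :- (u :* v′ :+ v :* u′ :+ a :* (v :* v′)) :* v″ :=
                  u :* (u′ :* u″ :- v′ :* v″) :- v :* (u′ :* v″ :+ v′ :* u″ :+ a :* (v′ :* v″)))
                  refl a u v u′ v′ u″ v″ ,
                solve 7 (λ a u v u′ v′ u″ v″ →
                  (u :* u′ :- v :* v′) :* v″ :+ (u :* v′ :+ v :* u′ :+ a :* (v :* v′)) :* u″
                    :+ a :* ((u :* v′ :+ v :* u′ :+ a :* (v :* v′)) :* v″) :=
                  u :* (u′ :* v″ :+ v′ :* u″ :+ a :* (v′ :* v″)) :+ v :* (u′ :* u″ :- v′ :* v″)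
                    :+ a :* (v :* (u′ :* v″ :+ v′ :* u″ :+ a :* (v′ :* v″))))
                  refl a u v u′ v′ u″ v″ }
          ; identity = (λ (u , v) →
              solve 2 (λ u v → con (+ 1) :* u :- con (+ 0) :* v := u) refl u v ,
              solve 3 (λ a u v → con (+ 1) :* v :+ con (+ 0) :* u :+ a :* (con (+ 0) :* v) := v) refl a u v) ,
            (λ (u , v) →
              solve 2 (λ u v → u :* con (+ 1) :- v :* con (+ 0) := u) refl u v ,
              solve 3 (λ a u v → u :* con (+ 0) :+ v :* con (+ 1) :+ a :* (v :* con (+ 0)) := v) refl a u v) }
        ; comm = λ (u , v) (u′ , v′) →
            solve 4 (λ u v u′ v′ → u :* u′ :- v :* v′ := u′ :* u :- v′ :* v) refl u v u′ v′ ,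
            solve 5 (λ a u v u′ v′ → u :* v′ :+ v :* u′ :+ a :* (v :* v′) :=
                                     u′ :* v :+ v′ :* u :+ a :* (v′ :* v)) refl a u v u′ v′ }
      ; distribʳ = λ (u″ , v″) (u , v) (u′ , v′) →
          solve 6 (λ u v u′ v′ u″ v″ → (u :+ u′) :* u″ :- (v :+ v′) :* v″ :=
                                       (u :* u″ :- v :* v″) :+ (u′ :* u″ :- v′ :* v″)) refl u v u′ v′ u″ v″ ,
          solve 7 (λ a u v u′ v′ u″ v″ →
            (u :+ u′) :* v″ :+ (v :+ v′) :* u″ :+ a :* ((v :+ v′) :* v″) :=
            (u :* v″ :+ v :* u″ :+ a :* (v :* v″)) :+ (u′ :* v″ :+ v′ :* u″ :+ a :* (v′ :* v″)))
            refl a u v u′ v′ u″ v″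
      ; zeroˡ = λ (u , v) →
          solve 2 (λ u v → con (+ 0) :* u :- con (+ 0) :* v := con (+ 0)) refl u v ,
          solve 3 (λ a u v → con (+ 0) :* v :+ con (+ 0) :* u :+ a :* (con (+ 0) :* v) := con (+ 0)) refl a u v
      }
    }

  private
    module E = CommutativeSemiring E
  open import Algebra.Properties.Semiring.Exp E.semiring using (_^_)
  open import Algebra.Properties.Semiring.Exp semiring using () renaming (_^_ to _^ᴿ_)
  open import Algebra.Properties.Semiring.Mult semiring renaming (_×_ to _·_)
  open import Algebra.Properties.Semiring.Mult E.semiring using () renaming (_×_ to _·ᴱ_)
  open Chebyshev R using (T)
  open import Relation.Binary.Reasoning.Setoid E.setoid

  -- Since z² - az + 1 = 0, the inverse of z is a - z, the other root of the same quadratic.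
  z z⁻¹ : Carrier × Carrier
  z   = 0# , 1#
  z⁻¹ = a , - 1#

  embed-^ : ∀ x n → (x , 0#) ^ n E.≈ (x ^ᴿ n , 0#)
  embed-^ x zero = E.refl
  embed-^ x (suc n) = E.trans (E.*-congˡ {(x , 0#)} (embed-^ x n))
    ( solve 2 (λ x y → x :* y :- con (+ 0) :* con (+ 0) := x :* y) refl x _
    , solve 3 (λ a x y → x :* con (+ 0) :+ con (+ 0) :* y :+ a :* (con (+ 0) :* con (+ 0)) := con (+ 0)) refl a x (x ^ᴿ n))

  embed-· : ∀ n → n ·ᴱ E.1# E.≈ (n · 1# , 0#)
  embed-· zero = E.refl
  embed-· (suc n) = E.trans (E.+-congˡ {E.1#} (embed-· n)) (refl , +-identityˡ 0#)

  -- Both z and z⁻¹ are roots of x² = ax - 1, so the sums of their powers satisfy the recurrence of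
  -- `T`.
  trace-^ : ∀ n → z ^ n E.+ z⁻¹ ^ n E.≈ (T n a , 0#)
  trace-^ zero = refl , +-identityˡ 0#
  trace-^ (suc zero) =
    solve 1 (λ a → (con (+ 0) :* con (+ 1) :- con (+ 1) :* con (+ 0))
               :+ (a :* con (+ 1) :- (:- con (+ 1)) :* con (+ 0)) := a) refl a ,
    solve 1 (λ a → (con (+ 0) :* con (+ 0) :+ con (+ 1) :* con (+ 1) :+ a :* (con (+ 1) :* con (+ 0)))
               :+ (a :* con (+ 0) :+ (:- con (+ 1)) :* con (+ 1) :+ a :* ((:- con (+ 1)) :* con (+ 0))) := con (+ 0)) refl a
  trace-^ (suc (suc n)) = step (z ^ n) (z⁻¹ ^ n) (trace-^ (suc n)) (trace-^ n)
    where
    -- The powers are generalised to arbitrary p and q, whose components can then serve as solver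
    -- variables.
    step : ∀ p q → z E.* p E.+ z⁻¹ E.* q E.≈ (T (suc n) a , 0#) → p E.+ q E.≈ (T n a , 0#) →
           z E.* (z E.* p) E.+ z⁻¹ E.* (z⁻¹ E.* q) E.≈ (T (suc (suc n)) a , 0#)
    step (u , v) (u′ , v′) (h₁ , h₂) (h₃ , h₄) =
      trans (solve 5 (λ a u v u′ v′ →
               let zp₁ = con (+ 0) :* u :- con (+ 1) :* v
                   zp₂ = con (+ 0) :* v :+ con (+ 1) :* u :+ a :* (con (+ 1) :* v)
                   wq₁ = a :* u′ :- (:- con (+ 1)) :* v′
                   wq₂ = a :* v′ :+ (:- con (+ 1)) :* u′ :+ a :* ((:- con (+ 1)) :* v′)
               in (con (+ 0) :* zp₁ :- con (+ 1) :* zp₂) :+ (a :* wq₁ :- (:- con (+ 1)) :* wq₂)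
                  := a :* (zp₁ :+ wq₁) :- (u :+ u′)) refl a u v u′ v′)
            (+-cong (*-congˡ h₁) (-‿cong h₃)) ,
      trans (solve 5 (λ a u v u′ v′ →
               let zp₁ = con (+ 0) :* u :- con (+ 1) :* v
                   zp₂ = con (+ 0) :* v :+ con (+ 1) :* u :+ a :* (con (+ 1) :* v)
                   wq₁ = a :* u′ :- (:- con (+ 1)) :* v′
                   wq₂ = a :* v′ :+ (:- con (+ 1)) :* u′ :+ a :* ((:- con (+ 1)) :* v′)
               in (con (+ 0) :* zp₂ :+ con (+ 1) :* zp₁ :+ a :* (con (+ 1) :* zp₂))
                  :+ (a :* wq₂ :+ (:- con (+ 1)) :* wq₁ :+ a :* ((:- con (+ 1)) :* wq₂))
                  := a :* (zp₂ :+ wq₂) :- (v :+ v′)) refl a u v u′ v′)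
            (trans (+-cong (*-congˡ h₂) (-‿cong h₄))
                   (solve 1 (λ a → a :* con (+ 0) :- con (+ 0) := con (+ 0)) refl a))

  T-prime : ∀ {p} → Prime p → p · 1# ≈ 0# → T p a ≈ a ^ᴿ p
  T-prime {p} p-prime p·1≈0 = proj₁ (begin
    (T p a , 0#)          ≈⟨ trace-^ p ⟨
    z ^ p E.+ z⁻¹ ^ p     ≈⟨ Frobenius.frobenius-+ E p-prime (E.trans (embed-· p) (p·1≈0 , refl)) z z⁻¹ ⟨
    (z E.+ z⁻¹) ^ p       ≈⟨ ^-congˡ p (+-identityˡ a , -‿inverseʳ 1#) ⟩
    (a , 0#) ^ p          ≈⟨ embed-^ a p ⟩
    (a ^ᴿ p , 0#)         ∎)
    where open import Algebra.Properties.Semiring.Exp E.semiring using (^-congˡ)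

-- Polynomial functions with a leading coefficient

module Polynomials {c e} (R : CommutativeRing c e) where
  open CommutativeRing R
  open IntegerCoefficients R
  open Chebyshev R using (T)
  open import Relation.Binary.Reasoning.Setoid setoid

  -- Poly k d f: f is a polynomial function of degree at most d whose coefficient of x^d is k.
  data Poly : Carrier → ℕ → (Carrier → Carrier) → Set (c Level.⊔ e) where
    constant : ∀ {k f} → (∀ x → f x ≈ k) → Poly k 0 f
    horner   : ∀ {k d f g} b → Poly k d g → (∀ x → f x ≈ x * g x + b) → Poly k (suc d) f

  Poly-≈ : ∀ {k k′ d f f′} → k ≈ k′ → (∀ x → f x ≈ f′ x) → Poly k d f → Poly k′ d f′
  Poly-≈ k≈k′ f≈f′ (constant f≈k) = constant (λ x → trans (sym (f≈f′ x)) (trans (f≈k x) k≈k′))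
  Poly-≈ k≈k′ f≈f′ (horner b g f≈) =
    horner b (Poly-≈ k≈k′ (λ _ → refl) g) (λ x → trans (sym (f≈f′ x)) (f≈ x))

  Poly-+ : ∀ {k k′ d f f′} → Poly k d f → Poly k′ d f′ → Poly (k + k′) d (λ x → f x + f′ x)
  Poly-+ (constant f≈k) (constant f≈k′) = constant (λ x → +-cong (f≈k x) (f≈k′ x))
  Poly-+ (horner b g f≈) (horner b′ g′ f′≈) = horner (b + b′) (Poly-+ g g′) (λ x →
    trans (+-cong (f≈ x) (f′≈ x))
      (solve 5 (λ x g b g′ b′ → (x :* g :+ b) :+ (x :* g′ :+ b′) := x :* (g :+ g′) :+ (b :+ b′))
        refl x _ b _ b′))

  Poly-scale : ∀ r {k d f} → Poly k d f → Poly (r * k) d (λ x → r * f x)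
  Poly-scale r (constant f≈k) = constant (λ x → *-congˡ (f≈k x))
  Poly-scale r (horner b g f≈) = horner (r * b) (Poly-scale r g) (λ x →
    trans (*-congˡ (f≈ x)) (solve 4 (λ r x g b → r :* (x :* g :+ b) := x :* (r :* g) :+ r :* b) refl r x _ b))

  Poly-neg : ∀ {k d f} → Poly k d f → Poly (- k) d (λ x → - f x)
  Poly-neg p = Poly-≈ (neg _) (λ x → neg _) (Poly-scale (- 1#) p)
    where
    neg : ∀ y → - 1# * y ≈ - y
    neg y = solve 1 (λ y → (:- con (+ 1)) :* y := :- y) refl y

  Poly-suc : ∀ {k d f} → Poly k d f → Poly 0# (suc d) f
  Poly-suc (constant {k} f≈k) =
    horner k (constant (λ _ → refl)) (λ x → trans (f≈k x) (solve 2 (λ x k → k := x :* con (+ 0) :+ k) refl x k))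
  Poly-suc (horner b g f≈) = horner b (Poly-suc g) f≈

  -- Padding with zero leading coefficients raises the formal degree, so that `Poly-+`, which wants
  -- equal degrees, can add a polynomial of smaller degree.
  Poly-< : ∀ {k d d′ f} → d < d′ → Poly k d f → Poly 0# d′ f
  Poly-< {d′ = suc d′} (s≤s d≤d′) p with ℕₚ.m≤n⇒m<n∨m≡n d≤d′
  ... | inj₁ d<d′ = Poly-suc (Poly-< d<d′ p)
  ... | inj₂ ≡.refl = Poly-suc p

  Poly-lower : ∀ {k k′ d d′ f g} → d′ < d → Poly k d f → Poly k′ d′ g → Poly k d (λ x → f x + g x)
  Poly-lower d′<d p p′ = Poly-≈ (+-identityʳ _) (λ _ → refl) (Poly-+ p (Poly-< d′<d p′))

  Poly-x* : ∀ {k d f} → Poly k d f → Poly k (suc d) (λ x → x * f x)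
  Poly-x* p = horner 0# p (λ x → sym (+-identityʳ _))

  -- Synthetic division: if f = x g + b, then f(x) - f(r) = (x - r) g(x) + r (g(x) - g(r)), and the
  -- quotient obtained from g has smaller degree than g. The quotient h thus keeps the leading
  -- coefficient k, so a monic f has monic quotients in `roots-bound`.
  Poly-factor : ∀ {k d f} r → Poly k (suc d) f →
                ∃ λ h → Poly k d h × (∀ x → f x - f r ≈ (x - r) * h x)
  Poly-factor {k} {f = f} r (horner {g = g} b (constant g≈k) f≈) =
    _ , constant (λ _ → refl) , λ x → begin
      f x - f r                                 ≈⟨ +-cong (f≈ x) (-‿cong (f≈ r)) ⟩
      (x * g x + b) - (r * g r + b)
        ≈⟨ +-cong (+-congʳ (*-congˡ (g≈k x))) (-‿cong (+-congʳ (*-congˡ (g≈k r)))) ⟩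
      (x * k + b) - (r * k + b)
        ≈⟨ solve 4 (λ x r k b → (x :* k :+ b) :- (r :* k :+ b) := (x :- r) :* k) refl x r k b ⟩
      (x - r) * k                               ∎
  Poly-factor {k} {suc d} {f} r (horner {g = g} b pg@(horner _ _ _) f≈)
    with h , ph , g-factor ← Poly-factor r pg =
    (λ x → g x + r * h x) , Poly-lower ℕₚ.≤-refl pg (Poly-scale r ph) , λ x → begin
      f x - f r                                 ≈⟨ +-cong (f≈ x) (-‿cong (f≈ r)) ⟩
      (x * g x + b) - (r * g r + b)
        ≈⟨ solve 5 (λ x r g g′ b → (x :* g :+ b) :- (r :* g′ :+ b) := (x :- r) :* g :+ r :* (g :- g′)) refl x r (g x) (g r) b ⟩
      (x - r) * g x + r * (g x - g r)           ≈⟨ +-congˡ (*-congˡ (g-factor x)) ⟩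
      (x - r) * g x + r * ((x - r) * h x)
        ≈⟨ solve 4 (λ x r g h → (x :- r) :* g :+ r :* ((x :- r) :* h) := (x :- r) :* (g :+ r :* h)) refl x r (g x) (h x) ⟩
      (x - r) * (g x + r * h x)                 ∎

  Monic : ℕ → (Carrier → Carrier) → Set _
  Monic = Poly 1#

  -- The constant T_0 = 2 is not monic in a nontrivial ring. For the subtracted term of the
  -- recurrence, `T-poly` therefore leaves the leading coefficient open; its lower degree is all
  -- that matters.
  T-monic : ∀ n → Monic (suc n) (T (suc n))
  T-poly  : ∀ n → ∃ λ k → Poly k n (T n)
  T-monic zero = horner 0# (constant (λ _ → refl)) (λ x → solve 1 (λ x → x := x :* con (+ 1) :+ con (+ 0)) refl x)
  T-monic (suc n) = Poly-lower (ℕₚ.m<n⇒m<1+n ℕₚ.≤-refl) (Poly-x* (T-monic n)) (Poly-neg (proj₂ (T-poly n)))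
  T-poly zero = _ , constant (λ _ → refl)
  T-poly (suc n) = _ , T-monic n

-- Finite fields: Fermat, T_q as the identity, bounds on zeros

length-filter-∪ : ∀ {a p q r} {A : Set a} {P : A → Set p} {Q : A → Set q} {S : A → Set r}
  (P? : ∀ x → Dec (P x)) (Q? : ∀ x → Dec (Q x)) (S? : ∀ x → Dec (S x)) →
  (∀ x → P x → Q x ⊎ S x) → ∀ xs →
  length (filter P? xs) ≤ length (filter Q? xs) ℕ.+ length (filter S? xs)
length-filter-∪ P? Q? S? cover [] = z≤n
length-filter-∪ P? Q? S? cover (x ∷ xs) with ih ← length-filter-∪ P? Q? S? cover xs | P? x | Q? x | S? x
... | yes p | yes q | yes s = s≤s (ℕₚ.≤-trans ih (ℕₚ.+-monoʳ-≤ _ (ℕₚ.n≤1+n _)))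
... | yes p | yes q | no _  = s≤s ih
... | yes p | no _  | yes s = ℕₚ.≤-trans (s≤s ih) (ℕₚ.≤-reflexive (≡.sym (ℕₚ.+-suc _ _)))
... | yes p | no ¬q | no ¬s = contradiction (cover x p) [ ¬q , ¬s ]′
... | no _  | yes q | yes s = ℕₚ.≤-trans ih (ℕₚ.+-mono-≤ (ℕₚ.n≤1+n _) (ℕₚ.n≤1+n _))
... | no _  | yes q | no _  = ℕₚ.m≤n⇒m≤1+n ih
... | no _  | no _  | yes s = ℕₚ.≤-trans ih (ℕₚ.+-monoʳ-≤ _ (ℕₚ.n≤1+n _))
... | no _  | no _  | no _  = ih

module FiniteField {c e} (R : CommutativeRing c e) (q : ℕ) (F : IsFiniteFieldOfOrder R q) where
  open CommutativeRing R
  open IsFiniteFieldOfOrder F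
  open Inverse card using (to; from; strictlyInverseˡ; strictlyInverseʳ)
  open IntegerCoefficients R
  open Polynomials R
  open Chebyshev R using (T)
  open import Algebra.Properties.Semiring.Exp semiring
  open import Algebra.Properties.Semiring.Mult semiring renaming (_×_ to _·_)
  open import Relation.Binary.Reasoning.Setoid setoid

  1≉0 : ¬ 1# ≈ 0#
  1≉0 = proj₁ isField

  to-injective : ∀ {x y} → to x ≡ to y → x ≡ y
  to-injective {x} {y} eq = ≡.trans (≡.sym (strictlyInverseʳ x)) (≡.trans (≡.cong from eq) (strictlyInverseʳ y))

  from-injective : ∀ {i j} → from i ≡ from j → i ≡ j
  from-injective {i} {j} eq = ≡.trans (≡.sym (strictlyInverseˡ i)) (≡.trans (≡.cong to eq) (strictlyInverseˡ j))

  infix 4 _≟_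
  _≟_ : ∀ x y → Dec (x ≈ y)
  x ≟ y = Dec.map′ (≡⇒≈ ∘ to-injective) (≡.cong to ∘ ≈⇒≡) (to x Finₚ.≟ to y)

  x*y≈0⇒x≈0∨y≈0 : ∀ {x y} → x * y ≈ 0# → x ≈ 0# ⊎ y ≈ 0#
  x*y≈0⇒x≈0∨y≈0 {x} {y} xy≈0 with x ≟ 0#
  ... | yes x≈0 = inj₁ x≈0
  ... | no  x≉0 with x⁻¹ , xx⁻¹≈1 ← proj₂ isField x x≉0 = inj₂ (begin
    y             ≈⟨ solve 1 (λ y → y := y :* con (+ 1)) refl y ⟩
    y * 1#        ≈⟨ *-congˡ xx⁻¹≈1 ⟨
    y * (x * x⁻¹) ≈⟨ solve 3 (λ x y z → y :* (x :* z) := (x :* y) :* z) refl x y x⁻¹ ⟩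
    x * y * x⁻¹   ≈⟨ *-congʳ xy≈0 ⟩
    0# * x⁻¹      ≈⟨ zeroˡ _ ⟩
    0#            ∎)

  x-y≈0⇒x≈y : ∀ {x y} → x - y ≈ 0# → x ≈ y
  x-y≈0⇒x≈y {x} {y} x-y≈0 = begin
    x         ≈⟨ solve 2 (λ x y → x := (x :- y) :+ y) refl x y ⟩
    x - y + y ≈⟨ trans (+-congʳ x-y≈0) (+-identityˡ y) ⟩
    y         ∎

  x≈y⇒x-y≈0 : ∀ {x y} → x ≈ y → x - y ≈ 0#
  x≈y⇒x-y≈0 x≈y = trans (+-congʳ x≈y) (-‿inverseʳ _)

  *-cancelʳ-nonzero : ∀ {x y z} → ¬ z ≈ 0# → x * z ≈ y * z → x ≈ y
  *-cancelʳ-nonzero {x} {y} {z} z≉0 xz≈yz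
    with x*y≈0⇒x≈0∨y≈0 {x - y} {z}
           (trans (solve 3 (λ x y z → (x :- y) :* z := x :* z :- y :* z) refl x y z) (x≈y⇒x-y≈0 xz≈yz))
  ... | inj₁ x-y≈0 = x-y≈0⇒x≈y x-y≈0
  ... | inj₂ z≈0 = contradiction z≈0 z≉0

  ^≈0⇒≈0 : ∀ {x} n → x ^ n ≈ 0# → x ≈ 0#
  ^≈0⇒≈0 zero 1≈0 = contradiction 1≈0 1≉0
  ^≈0⇒≈0 (suc n) xx^n≈0 = [ id , ^≈0⇒≈0 n ]′ (x*y≈0⇒x≈0∨y≈0 xx^n≈0)

  module _ {m ℓ} (M : CommutativeMonoid m ℓ) where
    open CommutativeMonoid M using () renaming (Carrier to |M|; _≈_ to _≈ᴹ_)
    open import Algebra.Properties.CommutativeMonoid.Sum M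

    -- The monoid is arbitrary because this serves both the sum over the field in `order·1≈0` and
    -- the product in `fermat`.
    reindex : ∀ (h : Carrier → |M|) (f g : Carrier → Carrier) →
              (∀ x → f (g x) ≈ x) → (∀ x → g (f x) ≈ x) →
              sum (h ∘ from) ≈ᴹ sum (h ∘ f ∘ from)
    reindex h f g fg gf =
      CommutativeMonoid.trans M (sum-permute (h ∘ from) π)
        (CommutativeMonoid.reflexive M (sum-cong-≗ (λ i → ≡.cong h (strictlyInverseʳ (f (from i))))))
      where
      conjugate : (f g : Carrier → Carrier) → (∀ x → f (g x) ≈ x) → ∀ i → to (f (from (to (g (from i))))) ≡ i
      conjugate f g fg i =
        ≡.trans (≡.cong (to ∘ f) (strictlyInverseʳ _))
          (≡.trans (≡.cong to (≈⇒≡ (fg (from i)))) (strictlyInverseˡ i))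
      π = permutation (to ∘ f ∘ from) (to ∘ g ∘ from) (conjugate f g fg) (conjugate g f gf)

  -- Translation by 1 permutes the field, so Σ x = Σ (x + 1) = Σ x + q · 1.
  order·1≈0 : q · 1# ≈ 0#
  order·1≈0 = begin
    q · 1#                         ≈⟨ sum-replicate q ⟨
    ∑1                             ≈⟨ solve 2 (λ x y → y := (x :+ y) :- x) refl ∑x ∑1 ⟩
    ∑x + ∑1 - ∑x                   ≈⟨ +-congʳ (∑-distrib-+ from (replicate q 1#)) ⟨
    sum (λ i → from i + 1#) - ∑x   ≈⟨ x≈y⇒x-y≈0 (sym shift) ⟩
    0#                             ∎
    where
    open import Algebra.Properties.CommutativeMonoid.Sum +-commutativeMonoid
    ∑x = sum from
    ∑1 = sum (replicate q 1#)
    shift : ∑x ≈ sum (λ i → from i + 1#)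
    shift = reindex +-commutativeMonoid (λ x → x) (_+ 1#) (_- 1#)
      (λ x → solve 1 (λ x → x :- con (+ 1) :+ con (+ 1) := x) refl x)
      (λ x → solve 1 (λ x → x :+ con (+ 1) :- con (+ 1) := x) refl x)

  private
    module Product = Algebra.Properties.CommutativeMonoid.Sum *-commutativeMonoid

  product-nonzero : ∀ {n} (f : Fin n → Carrier) → (∀ i → ¬ f i ≈ 0#) → ¬ Product.sum f ≈ 0#
  product-nonzero {zero} f f≉0 = 1≉0
  product-nonzero {suc n} f f≉0 ∏≈0 =
    [ f≉0 Fin.zero , product-nonzero (f ∘ Fin.suc) (f≉0 ∘ Fin.suc) ]′ (x*y≈0⇒x≈0∨y≈0 ∏≈0)

  -- Multiplication by a ≠ 0 permutes the nonzero elements; the element 0 is given the factor 1.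
  fermat : ∀ a → a ^ q ≈ a
  fermat a with a ≟ 0#
  ... | yes a≈0 = begin
    a ^ q  ≈⟨ ^-congˡ q a≈0 ⟩
    0# ^ q ≈⟨ 0^ (to 0#) ⟩
    0#     ≈⟨ a≈0 ⟨
    a      ∎
    where
    0^ : ∀ {n} → Fin n → 0# ^ n ≈ 0#
    0^ {suc n} _ = zeroˡ _
  ... | no a≉0 with b , ab≈1 ← proj₂ isField a a≉0 = begin
    a ^ q                       ≈⟨ all-but-one from (to 0#) (≡⇒≈ (strictlyInverseʳ 0#)) from-injective ⟨
    a * Product.sum (u ∘ from)  ≈⟨ *-congˡ ∏u≈1 ⟩
    a * 1#                      ≈⟨ *-identityʳ a ⟩
    a                           ∎
    where
    choose : ∀ {x} → Dec (x ≈ 0#) → Carrier → Carrier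
    choose (yes _) y = 1#
    choose (no _)  y = y
    h u : Carrier → Carrier
    h x = choose (x ≟ 0#) x
    u x = choose (x ≟ 0#) a

    cancel : ∀ {x y} → x * y ≈ 1# → ∀ w → x * (y * w) ≈ w
    cancel xy≈1 w = trans (sym (*-assoc _ _ w)) (trans (*-congʳ xy≈1) (*-identityˡ w))

    h≉0 : ∀ x → ¬ h x ≈ 0#
    h≉0 x with x ≟ 0#
    ... | yes _  = 1≉0
    ... | no x≉0 = x≉0

    h-a* : ∀ x → h (a * x) ≈ u x * h x
    h-a* x with a * x ≟ 0# | x ≟ 0#
    ... | yes _    | yes _   = sym (*-identityˡ _)
    ... | yes ax≈0 | no x≉0  = contradiction (x*y≈0⇒x≈0∨y≈0 ax≈0) [ a≉0 , x≉0 ]′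
    ... | no ax≉0  | yes x≈0 = contradiction (trans (*-congˡ x≈0) (zeroʳ a)) ax≉0
    ... | no _     | no _    = refl

    ∏u≈1 : Product.sum (u ∘ from) ≈ 1#
    ∏u≈1 = *-cancelʳ-nonzero (product-nonzero (h ∘ from) (h≉0 ∘ from)) (begin
      Product.sum (u ∘ from) * Product.sum (h ∘ from)  ≈⟨ Product.∑-distrib-+ (u ∘ from) (h ∘ from) ⟨
      Product.sum (λ i → u (from i) * h (from i))      ≈⟨ Product.sum-cong-≋ (λ i → h-a* (from i)) ⟨
      Product.sum (λ i → h (a * from i))
        ≈⟨ reindex *-commutativeMonoid h (a *_) (b *_) (cancel ab≈1) (cancel (trans (*-comm b a) ab≈1)) ⟨
      Product.sum (h ∘ from)                           ≈⟨ *-identityˡ _ ⟨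
      1# * Product.sum (h ∘ from)                      ∎)

    all-but-one : ∀ {n} (x : Fin n → Carrier) i → x i ≈ 0# → (∀ {j k} → x j ≡ x k → j ≡ k) →
                  a * Product.sum (u ∘ x) ≈ a ^ n
    all-but-one {suc n} x i xᵢ≈0 x-injective = *-congˡ (begin
      Product.sum (u ∘ x)                            ≈⟨ Product.sum-remove {i = i} (u ∘ x) ⟩
      u (x i) * Product.sum (λ j → u (x (Fin.punchIn i j)))
        ≈⟨ *-cong at-zero (Product.sum-cong-≋ elsewhere) ⟩
      1# * Product.sum (replicate n a)               ≈⟨ *-identityˡ _ ⟩
      Product.sum (replicate n a)                    ≈⟨ Product.sum-replicate n ⟩
      a ^ n                                          ∎)
      where
      at-zero : u (x i) ≈ 1#
      at-zero with x i ≟ 0#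
      ... | yes _    = refl
      ... | no xᵢ≉0 = contradiction xᵢ≈0 xᵢ≉0
      elsewhere : ∀ j → u (x (Fin.punchIn i j)) ≈ a
      elsewhere j with x (Fin.punchIn i j) ≟ 0#
      ... | yes xⱼ≈0 = contradiction (x-injective (≈⇒≡ (trans xⱼ≈0 (sym xᵢ≈0)))) (Finₚ.punchInᵢ≢i i j)
      ... | no _     = refl

  T-order : ∀ {p n} → Prime p → q ≡ p ℕ.^ n → ∀ a → T q a ≈ a
  T-order {p} {n} p-prime ≡.refl a = trans (T-prime-power n a) (fermat a)
    where
    power·1 : ∀ k → (p ℕ.^ k) · 1# ≈ (p · 1#) ^ k
    power·1 zero = +-identityʳ 1#
    power·1 (suc k) = trans (×1-homo-* p (p ℕ.^ k)) (*-congˡ (power·1 k))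
    -- The characteristic is p: (p · 1)^n = q · 1 = 0, and a field has no nilpotents except 0.
    p·1≈0 : p · 1# ≈ 0#
    p·1≈0 = ^≈0⇒≈0 n (trans (sym (power·1 n)) order·1≈0)
    T-prime-power : ∀ k x → T (p ℕ.^ k) x ≈ x ^ (p ℕ.^ k)
    T-prime-power zero x = sym (*-identityʳ x)
    T-prime-power (suc k) x = begin
      T (p ℕ.* p ℕ.^ k) x    ≈⟨ ChebyshevIdentities.T-compose R p (p ℕ.^ k) x ⟨
      T p (T (p ℕ.^ k) x)    ≈⟨ QuadraticExtension.T-prime R _ p-prime p·1≈0 ⟩
      T (p ℕ.^ k) x ^ p      ≈⟨ ^-congˡ p (T-prime-power k x) ⟩
      (x ^ (p ℕ.^ k)) ^ p    ≈⟨ ^-assocʳ x (p ℕ.^ k) p ⟩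
      x ^ (p ℕ.^ k ℕ.* p)    ≡⟨ ≡.cong (x ^_) (ℕₚ.*-comm (p ℕ.^ k) p) ⟩
      x ^ (p ℕ.^ suc k)      ∎

  elements : List Carrier
  elements = List.tabulate from

  elements-unique : Unique elements
  elements-unique = tabulate⁺ from-injective

  ∈-elements : ∀ x → x ∈ elements
  ∈-elements x = ≡.subst (_∈ elements) (strictlyInverseʳ x) (∈-tabulate⁺ (to x))

  length-elements : length elements ≡ q
  length-elements = length-tabulate from

  roots-bound : ∀ {d f} → Monic d f → ∀ {L} → Unique L → All (λ x → f x ≈ 0#) L → length L ≤ d
  roots-bound p [] [] = z≤n
  roots-bound {zero} (constant f≈1) (_ ∷ _) (fx≈0 ∷ _) = contradiction (trans (sym (f≈1 _)) fx≈0) 1≉0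
  roots-bound {suc d} {f} p {r ∷ L} (r∉L ∷ L-unique) (fr≈0 ∷ L-roots)
    with h , ph , factor ← Poly-factor r p =
    s≤s (roots-bound ph L-unique (All.zipWith (λ (r≢x , fx≈0) → hx≈0 r≢x fx≈0) (r∉L , L-roots)))
    where
    hx≈0 : ∀ {x} → ¬ r ≡ x → f x ≈ 0# → h x ≈ 0#
    hx≈0 {x} r≢x fx≈0 =
      [ (λ x-r≈0 → contradiction (≡.sym (≈⇒≡ (x-y≈0⇒x≈y x-r≈0))) r≢x) , id ]′
      (x*y≈0⇒x≈0∨y≈0 (trans (sym (factor x)) (x≈y⇒x-y≈0 (trans fx≈0 (sym fr≈0)))))

-- Periods, and polynomials T_i - T_j with all zeros in the field

-- Here 2i = A + B is nonnegative, which rules out a negative i.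
half-sum : ∀ {A B i j} → i ℤ.+ j ≡ + A → i ℤ.- j ≡ + B → ∃ λ n → i ≡ + n × 2 ℕ.* n ≡ A ℕ.+ B
half-sum {A} {B} {i} {j} i+j≡A i-j≡B = double i (≡.trans (e i j) (≡.cong₂ ℤ._+_ i+j≡A i-j≡B))
  where
  e : ∀ i j → i ℤ.+ i ≡ (i ℤ.+ j) ℤ.+ (i ℤ.- j)
  e = ℤ-Solver.solve-∀
  double : ∀ i → i ℤ.+ i ≡ + (A ℕ.+ B) → ∃ λ n → i ≡ + n × 2 ℕ.* n ≡ A ℕ.+ B
  double (+ n) eq = n , ≡.refl , ≡.trans (≡.cong (n ℕ.+_) (ℕₚ.+-identityʳ n)) (ℤₚ.+-injective eq)

-- For j ≥ 0 use i = j + B, for j < 0 use i = A - j. The inequality makes T_i the leading term of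
-- T_i ± T_j.
∣half-difference∣<∣half-sum∣ : ∀ {A B i j} → 0 < A → 0 < B → i ℤ.+ j ≡ + A → i ℤ.- j ≡ + B → ∣ j ∣ < ∣ i ∣
∣half-difference∣<∣half-sum∣ {A} {B} {i} {+ m} 0<A 0<B i+j≡A i-j≡B =
  ≡.subst (λ i → m < ∣ i ∣) (≡.sym (≡.trans (e i (+ m)) (≡.cong (ℤ._+ + m) i-j≡B)))
    (ℕₚ.+-monoˡ-≤ m 0<B)
  where
  e : ∀ i j → i ≡ (i ℤ.- j) ℤ.+ j
  e = ℤ-Solver.solve-∀
∣half-difference∣<∣half-sum∣ {A} {B} {i} { -[1+ m ]} 0<A 0<B i+j≡A i-j≡B =
  ≡.subst (λ i → suc m < ∣ i ∣) (≡.sym (≡.trans (e i -[1+ m ]) (≡.cong (ℤ._- -[1+ m ]) i+j≡A)))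
    (ℕₚ.+-monoˡ-≤ (suc m) 0<A)
  where
  e : ∀ i j → i ≡ (i ℤ.+ j) ℤ.- j
  e = ℤ-Solver.solve-∀

module ChebyshevRoots {c e} (R : CommutativeRing c e) (q : ℕ) (F : IsFiniteFieldOfOrder R q) where
  open CommutativeRing R
  open IntegerCoefficients R
  open Chebyshev R using (T)
  open ChebyshevIdentities R
  open Polynomials R
  open FiniteField R q F
  open import Relation.Binary.Reasoning.Setoid setoid

  module Periods (a : Carrier) where

    τₐ : ℤ → Carrier
    τₐ = τ a

    -- D is a period exactly when τ (i + D) = τ i for all i, i.e. zᴰ = 1 up to a nilpotent for a = z + z⁻¹.
    record IsPeriod (D : ℤ) : Set e where
      constructor period
      field τ-D≈2 : τₐ D ≈ 1# + 1#
    open IsPeriod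

    period-≡ : ∀ {D D′} → D ≡ D′ → IsPeriod D → IsPeriod D′
    period-≡ = ≡.subst IsPeriod

    τ-≈⇒period : ∀ i j → τₐ i ≈ τₐ j → IsPeriod (i ℤ.+ j) ⊎ IsPeriod (i ℤ.- j)
    τ-≈⇒period i j τi≈τj =
      Sum.map (λ h → period (x-y≈0⇒x≈y h)) (λ h → period (x-y≈0⇒x≈y h)) (x*y≈0⇒x≈0∨y≈0
        (trans (sym (τ-difference² a i j)) (trans (*-congʳ (x≈y⇒x-y≈0 τi≈τj)) (zeroˡ _))))

    -- At the indices i + D and i, the identity for the squared difference has the factor τ(D) - 2 =
    -- 0.
    period⇒τ-shift : ∀ {D} → IsPeriod D → ∀ i → τₐ (i ℤ.+ D) ≈ τₐ i
    period⇒τ-shift {D} pD i = x-y≈0⇒x≈y ([ id , id ]′ (x*y≈0⇒x≈0∨y≈0 (begin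
      (τₐ (i ℤ.+ D) - τₐ i) * (τₐ (i ℤ.+ D) - τₐ i)
        ≈⟨ τ-difference² a (i ℤ.+ D) i ⟩
      (τₐ (i ℤ.+ D ℤ.+ i) - (1# + 1#)) * (τₐ (i ℤ.+ D ℤ.- i) - (1# + 1#))
        ≈⟨ *-congˡ (x≈y⇒x-y≈0 (trans (τ-≡ a (index i D)) (τ-D≈2 pD))) ⟩
      (τₐ (i ℤ.+ D ℤ.+ i) - (1# + 1#)) * 0#                                     ≈⟨ zeroʳ _ ⟩
      0#                                                                        ∎)))
      where
      index : ∀ i D → i ℤ.+ D ℤ.- i ≡ D
      index = ℤ-Solver.solve-∀

    period⇒τ-≈ : ∀ i j → IsPeriod (i ℤ.+ j) ⊎ IsPeriod (i ℤ.- j) → τₐ i ≈ τₐ j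
    period⇒τ-≈ i j (inj₁ p) =
      trans (τ-≡ a (index i j)) (trans (period⇒τ-shift p (ℤ.- j)) (τ-neg a j))
      where
      index : ∀ i j → i ≡ ℤ.- j ℤ.+ (i ℤ.+ j)
      index = ℤ-Solver.solve-∀
    period⇒τ-≈ i j (inj₂ p) = trans (τ-≡ a (index i j)) (period⇒τ-shift p j)
      where
      index : ∀ i j → i ≡ j ℤ.+ (i ℤ.- j)
      index = ℤ-Solver.solve-∀

    period-* : ∀ k {n} → IsPeriod (+ n) → IsPeriod (+ (k ℕ.* n))
    period-* zero p = period refl
    period-* (suc k) {n} p = period
      (trans (τ-≡ a (ℤₚ.+-comm (+ n) (+ (k ℕ.* n)))) (trans (period⇒τ-shift p (+ (k ℕ.* n))) (τ-D≈2 (period-* k p))))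

    period-∣ : ∀ {m n} → m ∣ n → IsPeriod (+ m) → IsPeriod (+ n)
    period-∣ (divides k ≡.refl) = period-* k

    period-cancel : ∀ {d m n} → d ℕ.+ m ≡ n → IsPeriod (+ m) → IsPeriod (+ n) → IsPeriod (+ d)
    period-cancel {d} ≡.refl pm pn = period (trans (sym (period⇒τ-shift pm (+ d))) (τ-D≈2 pn))

    -- Bézout over ℕ comes in two cases, according to which multiple is larger; in each the gcd is a
    -- difference of two periods.
    period-gcd : ∀ {m n} → IsPeriod (+ m) → IsPeriod (+ n) → IsPeriod (+ gcd m n)
    period-gcd {m} {n} pm pn with Bézout.identity (gcd-GCD m n)
    ... | Bézout.+- x y eq = period-cancel eq (period-* y pn) (period-* x pm)
    ... | Bézout.-+ x y eq = period-cancel eq (period-* x pm) (period-* y pn)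

  zeros : (Carrier → Carrier) → List Carrier
  zeros f = filter (λ a → f a ≟ 0#) elements

  zeros-bound : ∀ {d f} → Monic d f → length (zeros f) ≤ d
  zeros-bound {f = f} p = roots-bound p
    (filter⁺ (λ a → f a ≟ 0#) elements-unique) (all-filter (λ a → f a ≟ 0#) elements)

  -- Each of the d + d′ zeros of f is a zero of g or of h. These have at most d and d′ zeros, so
  -- neither bound can be strict.
  zeros-factor : ∀ {d d′ f g h} → Monic d g → Monic d′ h → (∀ a → g a * h a ≈ f a) →
                 length (zeros f) ≡ d ℕ.+ d′ → length (zeros g) ≡ d
  zeros-factor {d} {d′} {f} {g} {h} pg ph gh≈f length-f = ℕₚ.≤-antisym (zeros-bound pg)
    (ℕₚ.+-cancelʳ-≤ d′ d _ (ℕₚ.≤-trans (ℕₚ.≤-reflexive (≡.sym length-f)) (ℕₚ.≤-trans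
      (length-filter-∪ _ _ _ (λ a fa≈0 → x*y≈0⇒x≈0∨y≈0 (trans (gh≈f a) fa≈0)) elements)
      (ℕₚ.+-monoʳ-≤ (length (zeros g)) (zeros-bound ph)))))

  τ-monic : ∀ i → 0 < ∣ i ∣ → Monic ∣ i ∣ (λ a → τ a i)
  τ-monic i 0<i with ∣ i ∣ | 0<i
  ... | suc n | _ = T-monic n

  -- T_i − T_j = z⁻ⁱ (z^A − 1) (z^B − 1) has degree i = (A + B) / 2 and as many zeros in the field.
  record Splits (A B : ℕ) : Set (c Level.⊔ e) where
    field
      i j          : ℤ
      i+j≡A        : i ℤ.+ j ≡ + A
      i-j≡B        : i ℤ.- j ≡ + B
      length-zeros : length (zeros (λ a → τ a i - τ a j)) ≡ ∣ i ∣

  module _ {A B} (0<A : 0 < A) (0<B : 0 < B) {i j} (i+j≡A : i ℤ.+ j ≡ + A) (i-j≡B : i ℤ.- j ≡ + B) where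
    private
      ∣j∣<∣i∣ : ∣ j ∣ < ∣ i ∣
      ∣j∣<∣i∣ = ∣half-difference∣<∣half-sum∣ {A} {B} {i} {j} 0<A 0<B i+j≡A i-j≡B

    difference-monic : Monic ∣ i ∣ (λ a → τ a i - τ a j)
    difference-monic =
      Poly-lower ∣j∣<∣i∣ (τ-monic i (ℕₚ.≤-<-trans z≤n ∣j∣<∣i∣)) (Poly-neg (proj₂ (T-poly ∣ j ∣)))

    sum-monic : Monic ∣ i ∣ (λ a → τ a i + τ a j)
    sum-monic = Poly-lower ∣j∣<∣i∣ (τ-monic i (ℕₚ.≤-<-trans z≤n ∣j∣<∣i∣)) (proj₂ (T-poly ∣ j ∣))

    splits-factor : ∀ i′ j′ {d h} → ∣ i′ ∣ ≡ ∣ i ∣ ℕ.+ d → Monic d h →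
                    (∀ a → (τ a i - τ a j) * h a ≈ τ a i′ - τ a j′) →
                    length (zeros (λ a → τ a i′ - τ a j′)) ≡ ∣ i′ ∣ → Splits A B
    splits-factor i′ j′ degree h-monic factor length-f = record
      { i = i ; j = j ; i+j≡A = i+j≡A ; i-j≡B = i-j≡B
      ; length-zeros = zeros-factor difference-monic h-monic factor (≡.trans length-f degree) }

  -- Changing the sign of j exchanges sum and difference and leaves T_|j| alone. Steps that reduce A
  -- can thus be used for B.
  Splits-sym : ∀ {A B} → Splits A B → Splits B A
  Splits-sym {A} {B} s = record
    { i = i ; j = ℤ.- j ; i+j≡A = i-j≡B
    ; i-j≡B = ≡.trans (≡.cong (ℤ._+_ i) (ℤₚ.neg-involutive j)) i+j≡A
    ; length-zeros = ≡.trans (ℕₚ.≤-antisym (transfer (λ a h → trans (+-congˡ (-‿cong (sym (τ-neg a j)))) h))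
                                           (transfer (λ a h → trans (+-congˡ (-‿cong (τ-neg a j))) h))) length-zeros }
    where
    open Splits s
    -- Monotonicity is read off from `length-filter-∪` by taking the empty zero set of the constant
    -- 1 as the third set.
    transfer : ∀ {f g} → (∀ a → f a ≈ 0# → g a ≈ 0#) → length (zeros f) ≤ length (zeros g)
    transfer {f} {g} f⇒g = ≡.subst (length (zeros f) ≤_)
      (≡.trans (≡.cong (length (zeros g) ℕ.+_) none) (ℕₚ.+-identityʳ _))
      (length-filter-∪ _ _ (λ _ → 1# ≟ 0#) (λ a fa≈0 → inj₁ (f⇒g a fa≈0)) elements)
      where
      none : length (zeros (λ _ → 1#)) ≡ 0
      none = ℕₚ.n≤0⇒n≡0 (zeros-bound (constant (λ _ → refl)))

  -- Symmetric form of (z^((2m+1)A) − 1) / (z^A − 1).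
  cofactor : ℕ → ℕ → Carrier → Carrier
  cofactor A zero    a = 1#
  cofactor A (suc m) a = T (suc m ℕ.* A) a + cofactor A m a

  cofactor-monic : ∀ {A} → 0 < A → ∀ m → Monic (m ℕ.* A) (cofactor A m)
  cofactor-monic 0<A zero = constant (λ _ → refl)
  cofactor-monic {A} 0<A (suc m) =
    Poly-lower m*A<[1+m]*A (τ-monic (+ (suc m ℕ.* A)) (ℕₚ.≤-<-trans z≤n m*A<[1+m]*A)) (cofactor-monic 0<A m)
    where
    m*A<[1+m]*A : m ℕ.* A < suc m ℕ.* A
    m*A<[1+m]*A = ℕₚ.+-monoˡ-≤ (m ℕ.* A) 0<A

  -- Put S = (m + 1)A and S′ = mA. The product formula turns (T_i - T_j) T_S into terms at i ± S and
  -- j ± S. As i + j = A, the indices i - S and j - S are -(j + S′) and -(i + S′), so these terms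
  -- cancel against the identity for m.
  cofactor-identity : ∀ {A i j} → i ℤ.+ j ≡ + A → ∀ m a →
    (τ a i - τ a j) * cofactor A m a ≈ τ a (i ℤ.+ + (m ℕ.* A)) - τ a (j ℤ.+ + (m ℕ.* A))
  cofactor-identity {A} {i} {j} i+j≡A zero a =
    trans (*-identityʳ _) (+-cong (τ-≡ a (≡.sym (ℤₚ.+-identityʳ i))) (-‿cong (τ-≡ a (≡.sym (ℤₚ.+-identityʳ j)))))
  cofactor-identity {A} {i} {j} i+j≡A (suc m) a = begin
    (τ a i - τ a j) * (τ a S + cofactor A m a)
      ≈⟨ solve 4 (λ x y z w → (x :- y) :* (z :+ w) := (x :* z :- y :* z) :+ (x :- y) :* w) refl _ _ _ _ ⟩
    (τ a i * τ a S - τ a j * τ a S) + (τ a i - τ a j) * cofactor A m a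
      ≈⟨ +-cong (+-cong (τ-product a i S) (-‿cong (τ-product a j S))) (cofactor-identity {A} {i} {j} i+j≡A m a) ⟩
    ((τ a (i ℤ.+ S) + τ a (i ℤ.- S)) - (τ a (j ℤ.+ S) + τ a (j ℤ.- S))) + (τ a (i ℤ.+ S′) - τ a (j ℤ.+ S′))
      ≈⟨ +-congʳ (+-cong (+-congˡ (reflect i j i+j≡A)) (-‿cong (+-congˡ (reflect j i (≡.trans (ℤₚ.+-comm j i) i+j≡A))))) ⟩
    ((τ a (i ℤ.+ S) + τ a (j ℤ.+ S′)) - (τ a (j ℤ.+ S) + τ a (i ℤ.+ S′))) + (τ a (i ℤ.+ S′) - τ a (j ℤ.+ S′))
      ≈⟨ solve 4 (λ x y z w → ((x :+ w) :- (y :+ z)) :+ (z :- w) := x :- y) refl _ _ _ _ ⟩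
    τ a (i ℤ.+ S) - τ a (j ℤ.+ S) ∎
    where
    S S′ : ℤ
    S  = + (suc m ℕ.* A)
    S′ = + (m ℕ.* A)
    index : ∀ i j S′ → i ℤ.- (i ℤ.+ j ℤ.+ S′) ≡ ℤ.- (j ℤ.+ S′)
    index = ℤ-Solver.solve-∀
    reflect : ∀ i j → i ℤ.+ j ≡ + A → τ a (i ℤ.- S) ≈ τ a (j ℤ.+ S′)
    reflect i j i+j≡A = trans
      (τ-≡ a (≡.trans (≡.cong (λ x → i ℤ.- (x ℤ.+ S′)) (≡.sym i+j≡A)) (index i j S′)))
      (τ-neg a (j ℤ.+ S′))

  shift-degree : ∀ {A B i j} → i ℤ.+ j ≡ + A → i ℤ.- j ≡ + B → ∀ d → ∣ i ℤ.+ + d ∣ ≡ ∣ i ∣ ℕ.+ d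
  shift-degree {i = i} {j} i+j≡A i-j≡B d with _ , ≡.refl , _ ← half-sum {i = i} {j} i+j≡A i-j≡B = ≡.refl

  -- Lowering both indices by mA preserves their difference B and lowers their sum from (2m + 1)A to
  -- A; the quotient of the two polynomials is `cofactor A m`, of degree mA.
  Splits-odd : ∀ m {A B} → 0 < A → 0 < B → Splits (suc (2 ℕ.* m) ℕ.* A) B → Splits A B
  Splits-odd m {A} {B} 0<A 0<B s =
    splits-factor 0<A 0<B {i₀} {j₀} sum≡A difference≡B (i₀ ℤ.+ M) (j₀ ℤ.+ M)
      (shift-degree {i = i₀} {j₀} sum≡A difference≡B (m ℕ.* A)) (cofactor-monic 0<A m)
      (cofactor-identity {A} {i₀} {j₀} sum≡A m)
      (≡.subst₂ (λ x y → length (zeros (λ a → τ a x - τ a y)) ≡ ∣ x ∣) (restore i M) (restore j M) length-zeros)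
    where
    open Splits s
    M i₀ j₀ : ℤ
    M = + (m ℕ.* A)
    i₀ = i ℤ.- M
    j₀ = j ℤ.- M
    restore : ∀ i M → i ≡ i ℤ.- M ℤ.+ M
    restore = ℤ-Solver.solve-∀
    regroup : ∀ i j M → (i ℤ.- M) ℤ.+ (j ℤ.- M) ≡ (i ℤ.+ j) ℤ.- (M ℤ.+ M)
    regroup = ℤ-Solver.solve-∀
    cancel : ∀ A M → (A ℤ.+ (M ℤ.+ M)) ℤ.- (M ℤ.+ M) ≡ A
    cancel = ℤ-Solver.solve-∀
    expand : suc (2 ℕ.* m) ℕ.* A ≡ A ℕ.+ (m ℕ.* A ℕ.+ m ℕ.* A)
    expand = ≡.cong (A ℕ.+_) (≡.trans (ℕₚ.*-distribʳ-+ A m (m ℕ.+ 0))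
      (≡.cong (λ x → m ℕ.* A ℕ.+ x ℕ.* A) (ℕₚ.+-identityʳ m)))
    sum≡A : i₀ ℤ.+ j₀ ≡ + A
    sum≡A = ≡.trans (regroup i j M) (≡.trans
      (≡.cong (ℤ._- (M ℤ.+ M)) (≡.trans i+j≡A (≡.cong +_ expand))) (cancel (+ A) M))
    difference : ∀ i j M → (i ℤ.- M) ℤ.- (j ℤ.- M) ≡ i ℤ.- j
    difference = ℤ-Solver.solve-∀
    difference≡B : i₀ ℤ.- j₀ ≡ + B
    difference≡B = ≡.trans (difference i j M) i-j≡B

  -- The quotient of z^(4h) - 1 by z^(2h) - 1 is z^(2h) + 1 = z^h T_h(a), so the cofactor is T_h, a
  -- polynomial in a because 2h is even. In `identity` the terms at i₀ - h and j₀ - h cancel, these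
  -- indices being opposite.
  Splits-even : ∀ {h B} → 0 < h → 0 < B → Splits (2 ℕ.* (2 ℕ.* h)) B → Splits (2 ℕ.* h) B
  Splits-even {h} {B} 0<h 0<B s =
    splits-factor (ℕₚ.≤-trans 0<h (ℕₚ.m≤m+n h _)) 0<B {i₀} {j₀} sum≡A difference≡B (i₀ ℤ.+ H) (j₀ ℤ.+ H)
      (shift-degree {i = i₀} {j₀} sum≡A difference≡B h) (τ-monic H 0<h) identity
      (≡.subst₂ (λ x y → length (zeros (λ a → τ a x - τ a y)) ≡ ∣ x ∣) (restore i H) (restore j H) length-zeros)
    where
    open Splits s
    H i₀ j₀ : ℤ
    H = + h
    i₀ = i ℤ.- H
    j₀ = j ℤ.- H
    restore : ∀ i M → i ≡ i ℤ.- M ℤ.+ M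
    restore = ℤ-Solver.solve-∀
    regroup : ∀ i j M → (i ℤ.- M) ℤ.+ (j ℤ.- M) ≡ (i ℤ.+ j) ℤ.- (M ℤ.+ M)
    regroup = ℤ-Solver.solve-∀
    cancel : ∀ x → (x ℤ.+ x) ℤ.- x ≡ x
    cancel = ℤ-Solver.solve-∀
    double : ∀ n → 2 ℕ.* n ≡ n ℕ.+ n
    double n = ≡.cong (n ℕ.+_) (ℕₚ.+-identityʳ n)
    sum≡2h : i₀ ℤ.+ j₀ ≡ H ℤ.+ H
    sum≡2h = ≡.trans (regroup i j H) (≡.trans
      (≡.cong (ℤ._- (H ℤ.+ H)) (≡.trans i+j≡A (≡.cong +_
        (≡.trans (double (2 ℕ.* h)) (≡.cong₂ ℕ._+_ (double h) (double h))))))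
      (cancel (H ℤ.+ H)))
    sum≡A : i₀ ℤ.+ j₀ ≡ + (2 ℕ.* h)
    sum≡A = ≡.trans sum≡2h (≡.cong +_ (≡.sym (double h)))
    difference : ∀ i j M → (i ℤ.- M) ℤ.- (j ℤ.- M) ≡ i ℤ.- j
    difference = ℤ-Solver.solve-∀
    difference≡B : i₀ ℤ.- j₀ ≡ + B
    difference≡B = ≡.trans (difference i j H) i-j≡B
    index : ∀ i j H → i ℤ.- H ≡ (i ℤ.+ j) ℤ.- (H ℤ.+ H) ℤ.- (j ℤ.- H)
    index = ℤ-Solver.solve-∀
    zero- : ∀ x y → x ℤ.- x ℤ.- y ≡ ℤ.- y
    zero- = ℤ-Solver.solve-∀
    identity : ∀ a → (τ a i₀ - τ a j₀) * τ a H ≈ τ a (i₀ ℤ.+ H) - τ a (j₀ ℤ.+ H)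
    identity a = begin
      (τ a i₀ - τ a j₀) * τ a H
        ≈⟨ solve 3 (λ x y z → (x :- y) :* z := x :* z :- y :* z) refl _ _ _ ⟩
      τ a i₀ * τ a H - τ a j₀ * τ a H
        ≈⟨ +-cong (τ-product a i₀ H) (-‿cong (τ-product a j₀ H)) ⟩
      (τ a (i₀ ℤ.+ H) + τ a (i₀ ℤ.- H)) - (τ a (j₀ ℤ.+ H) + τ a (j₀ ℤ.- H))
        ≈⟨ +-congʳ (+-congˡ (trans (τ-≡ a (≡.trans (index i₀ j₀ H)
             (≡.trans (≡.cong (λ x → x ℤ.- (H ℤ.+ H) ℤ.- (j₀ ℤ.- H)) sum≡2h) (zero- (H ℤ.+ H) (j₀ ℤ.- H)))))
             (τ-neg a (j₀ ℤ.- H)))) ⟩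
      (τ a (i₀ ℤ.+ H) + τ a (j₀ ℤ.- H)) - (τ a (j₀ ℤ.+ H) + τ a (j₀ ℤ.- H))
        ≈⟨ solve 3 (λ x y z → (x :+ z) :- (y :+ z) := x :- y) refl _ _ _ ⟩
      τ a (i₀ ℤ.+ H) - τ a (j₀ ℤ.+ H) ∎

  -- From T_2i = T_i² - 2 comes T_2i - T_2j = (T_i - T_j)(T_i + T_j). Halving both numbers together
  -- handles odd A and B, where halving only one of 2A, 2B would leave numbers of different parity;
  -- A + B = 2n supplies the new index i = n.
  Splits-halve : ∀ {A B n} → 0 < A → 0 < B → A ℕ.+ B ≡ 2 ℕ.* n → Splits (2 ℕ.* A) (2 ℕ.* B) → Splits A B
  Splits-halve {A} {B} {n} 0<A 0<B A+B≡2n s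
    with n′ , i≡n′ , 2n′≡ ← half-sum {i = Splits.i s} {Splits.j s} (Splits.i+j≡A s) (Splits.i-j≡B s) =
    splits-factor 0<A 0<B {i₀} {j₀} sum≡A difference≡B (i₀ ℤ.+ i₀) (j₀ ℤ.+ j₀) ≡.refl
      (sum-monic 0<A 0<B {i₀} {j₀} sum≡A difference≡B) identity
      (≡.subst₂ (λ x y → length (zeros (λ a → τ a x - τ a y)) ≡ ∣ x ∣) i≡2i₀ j≡2j₀ length-zeros)
    where
    open Splits s
    i₀ j₀ : ℤ
    i₀ = + n
    j₀ = + n ℤ.- + B
    double : ∀ n → 2 ℕ.* n ≡ n ℕ.+ n
    double n = ≡.cong (n ℕ.+_) (ℕₚ.+-identityʳ n)
    A+B≡i₀+i₀ : + A ℤ.+ + B ≡ i₀ ℤ.+ i₀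
    A+B≡i₀+i₀ = ≡.cong +_ (≡.trans A+B≡2n (double n))
    sum≡A : i₀ ℤ.+ j₀ ≡ + A
    sum≡A = ≡.trans (≡.sym (ℤₚ.+-assoc i₀ i₀ (ℤ.- + B)))
      (≡.trans (≡.cong (ℤ._- + B) (≡.sym A+B≡i₀+i₀)) (cancel (+ A) (+ B)))
      where
      cancel : ∀ x y → (x ℤ.+ y) ℤ.- y ≡ x
      cancel = ℤ-Solver.solve-∀
    difference≡B : i₀ ℤ.- j₀ ≡ + B
    difference≡B = cancel i₀ (+ B)
      where
      cancel : ∀ x y → x ℤ.- (x ℤ.- y) ≡ y
      cancel = ℤ-Solver.solve-∀
    i≡2i₀ : i ≡ i₀ ℤ.+ i₀
    i≡2i₀ = ≡.trans i≡n′ (≡.trans (≡.cong +_ (ℕₚ.*-cancelˡ-≡ n′ (A ℕ.+ B) 2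
      (≡.trans 2n′≡ (≡.sym (ℕₚ.*-distribˡ-+ 2 A B))))) A+B≡i₀+i₀)
    j≡2j₀ : j ≡ j₀ ℤ.+ j₀
    j≡2j₀ = ≡.trans (e₁ i j) (≡.trans (≡.cong₂ ℤ._-_ i≡2i₀ (≡.trans i-j≡B (≡.cong +_ (double B)))) (e₂ i₀ (+ B)))
      where
      e₁ : ∀ i j → j ≡ i ℤ.- (i ℤ.- j)
      e₁ = ℤ-Solver.solve-∀
      e₂ : ∀ x y → (x ℤ.+ x) ℤ.- (y ℤ.+ y) ≡ (x ℤ.- y) ℤ.+ (x ℤ.- y)
      e₂ = ℤ-Solver.solve-∀
    identity : ∀ a → (τ a i₀ - τ a j₀) * (τ a i₀ + τ a j₀) ≈ τ a (i₀ ℤ.+ i₀) - τ a (j₀ ℤ.+ j₀)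
    identity a = sym (trans (+-cong (τ-double a i₀) (-‿cong (τ-double a j₀)))
      (solve 3 (λ x y z → (x :* x :- z) :- (y :* y :- z) := (x :- y) :* (x :+ y)) refl _ _ _))

  Splits-order : 1 ≤ q → (∀ a → T q a ≈ a) → Splits (q ℕ.∸ 1) (q ℕ.+ 1)
  Splits-order 1≤q T-q≈ = record
    -- The polynomial is T_q - T_1; taking j = -1 instead of 1 makes q - 1 the sum and q + 1 the
    -- difference.
    { i = + q ; j = ℤ.- + 1
    ; i+j≡A = ℤₚ.⊖-≥ 1≤q
    ; i-j≡B = ≡.refl
    ; length-zeros = ≡.trans
        (≡.cong length (filter-all (λ a → (τ a (+ q) - τ a (ℤ.- + 1)) ≟ 0#)
          (All.universal (λ a → x≈y⇒x-y≈0 (T-q≈ a)) elements)))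
        length-elements }

-- Divisibility and powers of l

coprime-^ : ∀ {l n} → Coprime l n → ∀ k → Coprime (l ℕ.^ k) n
coprime-^ l⊥n zero (d∣1 , _) = ∣1⇒≡1 d∣1
coprime-^ {l} {n} l⊥n (suc k) {d} (d∣l*l^k , d∣n) =
  coprime-^ l⊥n k (coprime-divisor (λ {d′} (d′∣d , d′∣l) → l⊥n (d′∣l , ∣-trans d′∣d d∣n)) d∣l*l^k , d∣n)

coprime-^+1 : ∀ l k → Coprime l (l ℕ.^ suc k ℕ.+ 1)
coprime-^+1 l k (d∣l , d∣l^k+1) = ∣1⇒≡1 (∣m+n∣m⇒∣n d∣l^k+1 (∣-trans d∣l (m∣m*n (l ℕ.^ k))))

coprime-^∸1 : ∀ l .{{_ : NonZero l}} k → Coprime l (l ℕ.^ suc k ∸ 1)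
coprime-^∸1 l k {d} (d∣l , d∣l^k∸1) =
  ∣1⇒≡1 (∣m+n∣m⇒∣n (≡.subst (d ∣_) (≡.sym (ℕₚ.m∸n+n≡m (ℕₚ.m^n>0 l (suc k)))) (∣-trans d∣l (m∣m*n (l ℕ.^ k)))) d∣l^k∸1)

-- For k ≤ s, d divides l^k · gcd(c, l^(s-k) ω). This gcd divides c, so it is coprime to l and must
-- divide ω.
∣-^-⊓ : ∀ {l c ω d} → Coprime l c → ∀ k s →
        d ∣ l ℕ.^ k ℕ.* c → d ∣ l ℕ.^ s ℕ.* ω → d ∣ l ℕ.^ (k ⊓ s) ℕ.* ω
∣-^-⊓ {l} {c} {ω} {d} l⊥c k s d∣l^k*c d∣l^s*ω with ℕₚ.≤-total k s
... | inj₂ s≤k = ≡.subst (λ t → d ∣ l ℕ.^ t ℕ.* ω) (≡.sym (ℕₚ.m≥n⇒m⊓n≡n s≤k)) d∣l^s*ω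
... | inj₁ k≤s = ≡.subst (λ t → d ∣ l ℕ.^ t ℕ.* ω) (≡.sym (ℕₚ.m≤n⇒m⊓n≡m k≤s))
  (∣-trans (≡.subst (d ∣_) (≡.sym (c*gcd[m,n]≡gcd[cm,cn] (l ℕ.^ k) c u))
             (gcd-greatest d∣l^k*c (≡.subst (d ∣_) split d∣l^s*ω)))
           (*-monoʳ-∣ (l ℕ.^ k) gcd∣ω))
  where
  u = l ℕ.^ (s ∸ k) ℕ.* ω
  split : l ℕ.^ s ℕ.* ω ≡ l ℕ.^ k ℕ.* u
  split = ≡.trans (≡.cong (ℕ._* ω) (≡.trans (≡.cong (l ℕ.^_) (≡.sym (ℕₚ.m+[n∸m]≡n k≤s)))
                                            (ℕₚ.^-distribˡ-+-* l k (s ∸ k))))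
                  (ℕₚ.*-assoc (l ℕ.^ k) (l ℕ.^ (s ∸ k)) ω)
  gcd∣ω : gcd c u ∣ ω
  gcd∣ω = coprime-divisor
    (λ (d′∣gcd , d′∣l^) → coprime-^ l⊥c (s ∸ k) (d′∣l^ , ∣-trans d′∣gcd (gcd[m,n]∣m c u)))
    (gcd[m,n]∣n c u)

≡%⇒∣∸ : ∀ m n o .{{_ : NonZero o}} → m % o ≡ n % o → o ∣ m ∸ n
≡%⇒∣∸ m n o m≡n = divides (m / o ∸ n / o) (begin
  m ∸ n
    ≡⟨ ≡.cong₂ _∸_ (m≡m%n+[m/n]*n m o) (m≡m%n+[m/n]*n n o) ⟩
  (m % o ℕ.+ m / o ℕ.* o) ∸ (n % o ℕ.+ n / o ℕ.* o)
    ≡⟨ ≡.cong (λ r → (r ℕ.+ m / o ℕ.* o) ∸ (n % o ℕ.+ n / o ℕ.* o)) m≡n ⟩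
  (n % o ℕ.+ m / o ℕ.* o) ∸ (n % o ℕ.+ n / o ℕ.* o)   ≡⟨ ℕₚ.[m+n]∸[m+o]≡n∸o (n % o) _ _ ⟩
  m / o ℕ.* o ∸ n / o ℕ.* o                           ≡⟨ ℕₚ.*-distribʳ-∸ o (m / o) (n / o) ⟨
  (m / o ∸ n / o) ℕ.* o                               ∎)
  where open ≡.≡-Reasoning

-- Among the ω + 1 powers l^0, ..., l^ω two agree modulo ω. Their difference is l^i (l^(j-i) - 1),
-- and l^i, being coprime to ω, can be cancelled.
coprime⇒∣^∸1 : ∀ {l ω} → 0 < ω → Coprime l ω → ∃ λ k → ω ∣ l ℕ.^ suc k ∸ 1
coprime⇒∣^∸1 {l} {ω@(suc _)} 0<ω l⊥ω
  with i , j , i<j , lⁱ≡lʲ ← Finₚ.pigeonhole ℕₚ.≤-refl (λ (i : Fin (suc ω)) → fromℕ< (m%n<n (l ℕ.^ toℕ i) ω)) =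
  toℕ j ∸ suc (toℕ i) , coprime-divisor (Coprimality.sym (coprime-^ l⊥ω (toℕ i))) (≡.subst (ω ∣_) split
    (≡%⇒∣∸ (l ℕ.^ toℕ j) (l ℕ.^ toℕ i) ω (≡.sym (Finₚ.fromℕ<-injective _ _ _ _ lⁱ≡lʲ))))
  where
  open ≡.≡-Reasoning
  s = toℕ j ∸ suc (toℕ i)
  split : l ℕ.^ toℕ j ∸ l ℕ.^ toℕ i ≡ l ℕ.^ toℕ i ℕ.* (l ℕ.^ suc s ∸ 1)
  split = begin
    l ℕ.^ toℕ j ∸ l ℕ.^ toℕ i
      ≡⟨ ≡.cong (λ k → l ℕ.^ k ∸ l ℕ.^ toℕ i) (≡.trans (ℕₚ.+-suc (toℕ i) s) (ℕₚ.m+[n∸m]≡n i<j)) ⟨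
    l ℕ.^ (toℕ i ℕ.+ suc s) ∸ l ℕ.^ toℕ i
      ≡⟨ ≡.cong₂ _∸_ (ℕₚ.^-distribˡ-+-* l (toℕ i) (suc s)) (≡.sym (ℕₚ.*-identityʳ (l ℕ.^ toℕ i))) ⟩
    l ℕ.^ toℕ i ℕ.* l ℕ.^ suc s ∸ l ℕ.^ toℕ i ℕ.* 1     ≡⟨ ℕₚ.*-distribˡ-∸ (l ℕ.^ toℕ i) (l ℕ.^ suc s) 1 ⟨
    l ℕ.^ toℕ i ℕ.* (l ℕ.^ suc s ∸ 1)                   ∎

even⊎odd : ∀ n → ∃ λ m → n ≡ 2 ℕ.* m ⊎ n ≡ suc (2 ℕ.* m)
even⊎odd zero = 0 , inj₁ ≡.refl
even⊎odd (suc n) with even⊎odd n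
... | m , inj₁ n≡2m = m , inj₂ (≡.cong suc n≡2m)
... | m , inj₂ n≡1+2m = suc m , inj₁ (≡.trans (≡.cong suc n≡1+2m) (≡.cong suc (≡.sym (ℕₚ.+-suc m (m ℕ.+ 0)))))

prime∣^⇒∣ : ∀ {p m} → Prime p → ∀ n → p ∣ m ℕ.^ n → p ∣ m
prime∣^⇒∣ p-prime zero p∣1 =
  contradiction (≡.sym (∣1⇒≡1 p∣1)) (ℕₚ.<⇒≢ (ℕ.nonTrivial⇒n>1 _ {{prime⇒nonTrivial p-prime}}))
prime∣^⇒∣ {p} {m} p-prime (suc n) p∣m*m^n = [ id , prime∣^⇒∣ p-prime n ]′ (euclidsLemma m (m ℕ.^ n) p-prime p∣m*m^n)

prime∣prime⇒≡ : ∀ {p r} → Prime p → Prime r → p ∣ r → p ≡ r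
prime∣prime⇒≡ p-prime r-prime p∣r with prime⇒irreducible r-prime p∣r
... | inj₂ p≡r = p≡r
... | inj₁ p≡1 = contradiction (≡.sym p≡1) (ℕₚ.<⇒≢ (ℕ.nonTrivial⇒n>1 _ {{prime⇒nonTrivial p-prime}}))

-- The bound `lo` is 0 for odd l and 1 for l = 2, where the last factor 2 cannot be removed from one
-- side alone.
descend : ∀ {a} (P : ℕ → Set a) {lo} → (∀ k → lo ≤ k → P (suc k) → P k) →
          ∀ {s t} → lo ≤ s → s ≤ t → P t → P s
descend P step {s} {t} lo≤s s≤t Pt with ℕₚ.m≤n⇒m<n∨m≡n s≤t
... | inj₂ ≡.refl = Pt
descend P step {s} {suc t} lo≤s _ Pt | inj₁ (s≤s s≤t) =
  descend P step lo≤s s≤t (step t (ℕₚ.≤-trans lo≤s s≤t) Pt)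

-- Index 1 is the side with the maximal exponent. As r is at most that exponent, l^r divides side 1,
-- hence not side 2, and so λ₂ < r ≤ k + 1. Side 2 is therefore the same at levels k and k + 1,
-- while side 1 grows from l^k ω₁ to l^(k+1) ω₁.
level-increment : ∀ {l λ₁ ω₁ λ₂ ω₂ ωm r k} .{{_ : NonZero l}} →
  ¬ ((l ℕ.^ r ∣ l ℕ.^ λ₁ ℕ.* ω₁) × (l ℕ.^ r ∣ l ℕ.^ λ₂ ℕ.* ω₂)) → r ≤ suc k → suc k ≤ λ₁ ⊔ λ₂ →
  l ℕ.^ (λ₁ ⊔ λ₂) ℕ.* ωm ≡ l ℕ.^ λ₁ ℕ.* ω₁ →
  l ℕ.^ (suc k ⊓ λ₁) ℕ.* ω₁ ℕ.+ l ℕ.^ (suc k ⊓ λ₂) ℕ.* ω₂ ≡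
  (l ℕ.^ (k ⊓ λ₁) ℕ.* ω₁ ℕ.+ l ℕ.^ (k ⊓ λ₂) ℕ.* ω₂) ℕ.+ (l ∸ 1) ℕ.* l ℕ.^ k ℕ.* ωm
level-increment {l} {λ₁} {ω₁} {λ₂} {ω₂} {ωm} {r} {k} l^r∤both r≤1+k 1+k≤λm eq = begin
  l ℕ.^ (suc k ⊓ λ₁) ℕ.* ω₁ ℕ.+ l ℕ.^ (suc k ⊓ λ₂) ℕ.* ω₂
    ≡⟨ ≡.cong₂ (λ s t → l ℕ.^ s ℕ.* ω₁ ℕ.+ l ℕ.^ t ℕ.* ω₂) (ℕₚ.m≤n⇒m⊓n≡m 1+k≤λ₁) (ℕₚ.m≥n⇒m⊓n≡n (ℕₚ.m≤n⇒m≤1+n λ₂≤k)) ⟩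
  l ℕ.^ suc k ℕ.* ω₁ ℕ.+ b
    ≡⟨ ≡.cong (λ x → x ℕ.* ω₁ ℕ.+ b) step ⟩
  (l ℕ.^ k ℕ.+ (l ∸ 1) ℕ.* l ℕ.^ k) ℕ.* ω₁ ℕ.+ b
    ≡⟨ ≡.cong (ℕ._+ b) (ℕₚ.*-distribʳ-+ ω₁ (l ℕ.^ k) ((l ∸ 1) ℕ.* l ℕ.^ k)) ⟩
  l ℕ.^ k ℕ.* ω₁ ℕ.+ (l ∸ 1) ℕ.* l ℕ.^ k ℕ.* ω₁ ℕ.+ b
    ≡⟨ xy∙z≈xz∙y (l ℕ.^ k ℕ.* ω₁) ((l ∸ 1) ℕ.* l ℕ.^ k ℕ.* ω₁) b ⟩
  l ℕ.^ k ℕ.* ω₁ ℕ.+ b ℕ.+ (l ∸ 1) ℕ.* l ℕ.^ k ℕ.* ω₁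
    ≡⟨ ≡.cong (λ ω → l ℕ.^ k ℕ.* ω₁ ℕ.+ b ℕ.+ (l ∸ 1) ℕ.* l ℕ.^ k ℕ.* ω) ωm≡ω₁ ⟨
  l ℕ.^ k ℕ.* ω₁ ℕ.+ b ℕ.+ (l ∸ 1) ℕ.* l ℕ.^ k ℕ.* ωm
    ≡⟨ ≡.cong₂ (λ s t → l ℕ.^ s ℕ.* ω₁ ℕ.+ l ℕ.^ t ℕ.* ω₂ ℕ.+ (l ∸ 1) ℕ.* l ℕ.^ k ℕ.* ωm)
         (ℕₚ.m≤n⇒m⊓n≡m (ℕₚ.<⇒≤ 1+k≤λ₁)) (ℕₚ.m≥n⇒m⊓n≡n λ₂≤k) ⟨
  (l ℕ.^ (k ⊓ λ₁) ℕ.* ω₁ ℕ.+ l ℕ.^ (k ⊓ λ₂) ℕ.* ω₂) ℕ.+ (l ∸ 1) ℕ.* l ℕ.^ k ℕ.* ωm ∎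
  where
  open ≡.≡-Reasoning
  b = l ℕ.^ λ₂ ℕ.* ω₂
  ^-mono-∣ : ∀ {s t} → s ≤ t → l ℕ.^ s ∣ l ℕ.^ t
  ^-mono-∣ {s} {t} s≤t = ≡.subst (l ℕ.^ s ∣_)
    (≡.trans (≡.sym (ℕₚ.^-distribˡ-+-* l s (t ∸ s))) (≡.cong (l ℕ.^_) (ℕₚ.m+[n∸m]≡n s≤t))) (m∣m*n (l ℕ.^ (t ∸ s)))
  l^r∣₁ : l ℕ.^ r ∣ l ℕ.^ λ₁ ℕ.* ω₁
  l^r∣₁ = ≡.subst (l ℕ.^ r ∣_) eq (∣-trans (^-mono-∣ (ℕₚ.≤-trans r≤1+k 1+k≤λm)) (m∣m*n ωm))
  λ₂≤k : λ₂ ≤ k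
  λ₂≤k with r ℕₚ.≤? λ₂
  ... | yes r≤λ₂ = contradiction (l^r∣₁ , ∣-trans (^-mono-∣ r≤λ₂) (m∣m*n ω₂)) l^r∤both
  ... | no  r≰λ₂ = ℕₚ.≤-pred (ℕₚ.≤-trans (ℕₚ.≰⇒> r≰λ₂) r≤1+k)
  λm≡λ₁ : λ₁ ⊔ λ₂ ≡ λ₁
  λm≡λ₁ with ℕₚ.≤-total λ₂ λ₁
  ... | inj₁ λ₂≤λ₁ = ℕₚ.m≥n⇒m⊔n≡m λ₂≤λ₁
  ... | inj₂ λ₁≤λ₂ = contradiction (≡.subst (suc k ≤_) (ℕₚ.m≤n⇒m⊔n≡n λ₁≤λ₂) 1+k≤λm) (ℕₚ.≤⇒≯ λ₂≤k)
  1+k≤λ₁ : suc k ≤ λ₁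
  1+k≤λ₁ = ≡.subst (suc k ≤_) λm≡λ₁ 1+k≤λm
  ωm≡ω₁ : ωm ≡ ω₁
  ωm≡ω₁ = ℕₚ.*-cancelˡ-≡ ωm ω₁ (l ℕ.^ λ₁) {{ℕₚ.m^n≢0 l λ₁}}
    (≡.subst (λ t → l ℕ.^ t ℕ.* ωm ≡ l ℕ.^ λ₁ ℕ.* ω₁) λm≡λ₁ eq)
  step : l ℕ.^ suc k ≡ l ℕ.^ k ℕ.+ (l ∸ 1) ℕ.* l ℕ.^ k
  step = ≡.cong (ℕ._* l ℕ.^ k) (≡.sym (ℕₚ.suc-pred l))

-- Preperiods in terms of periods, and their counts

length-filter-∖ : ∀ {a p r} {A : Set a} {P : A → Set p} {Q : A → Set r}
  (P? : ∀ x → Dec (P x)) (Q? : ∀ x → Dec (Q x)) → (∀ x → Q x → P x) → ∀ xs →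
  length (filter P? xs) ≡ length (filter Q? xs) ℕ.+ length (filter (λ x → ¬? (Q? x)) (filter P? xs))
length-filter-∖ P? Q? Q⊆P [] = ≡.refl
length-filter-∖ P? Q? Q⊆P (x ∷ xs) with ih ← length-filter-∖ P? Q? Q⊆P xs | P? x
... | no ¬p with Q? x
...   | yes q = contradiction (Q⊆P x q) ¬p
...   | no _  = ih
length-filter-∖ P? Q? Q⊆P (x ∷ xs) | yes p with Q? x
...   | yes q = ≡.cong suc ih
...   | no _  = ≡.trans (≡.cong suc ih) (≡.sym (ℕₚ.+-suc _ _))

module Preperiods
  {c e} (R : CommutativeRing c e) (q : ℕ) (F : IsFiniteFieldOfOrder R q)
  (T-q≈ : ∀ a → CommutativeRing._≈_ R (Chebyshev.T R q a) a) (2≤q : 2 ≤ q)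
  (l : ℕ) .{{_ : NonZero l}} (λ⁻ ω⁻ λ⁺ ω⁺ : ℕ)
  (q∸1≡ : q ∸ 1 ≡ l ℕ.^ λ⁻ ℕ.* ω⁻) (l⊥ω⁻ : Coprime l ω⁻)
  (q+1≡ : q ℕ.+ 1 ≡ l ℕ.^ λ⁺ ℕ.* ω⁺) (l⊥ω⁺ : Coprime l ω⁺)
  where

  open CommutativeRing R
  open Chebyshev R
  open ChebyshevIdentities R
  open FiniteField R q F
  open ChebyshevRoots R q F
  open IsFiniteFieldOfOrder F

  A⁻ A⁺ : ℕ → ℕ
  A⁻ k = l ℕ.^ (k ⊓ λ⁻) ℕ.* ω⁻
  A⁺ k = l ℕ.^ (k ⊓ λ⁺) ℕ.* ω⁺

  1≤q : 1 ≤ q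
  1≤q = ℕₚ.<⇒≤ 2≤q

  private
    positive : ∀ s {x ω} → 0 < x → x ≡ l ℕ.^ s ℕ.* ω → 0 < ω
    positive s {ω = zero} 0<x x≡ = contradiction 0<x (ℕₚ.≤⇒≯ (ℕₚ.≤-reflexive (≡.trans x≡ (ℕₚ.*-zeroʳ (l ℕ.^ s)))))
    positive s {ω = suc _} _ _ = s≤s z≤n

  0<ω⁻ : 0 < ω⁻
  0<ω⁻ = positive λ⁻ (ℕₚ.m<n⇒0<n∸m 2≤q) q∸1≡
  0<ω⁺ : 0 < ω⁺
  0<ω⁺ = positive λ⁺ (ℕₚ.≤-trans 1≤q (ℕₚ.m≤m+n q 1)) q+1≡

  q+1≡q∸1+2 : q ℕ.+ 1 ≡ (q ∸ 1) ℕ.+ 2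
  q+1≡q∸1+2 = ≡.trans (≡.cong (ℕ._+ 1) (≡.sym (ℕₚ.m∸n+n≡m 1≤q))) (ℕₚ.+-assoc (q ∸ 1) 1 1)

  -- A common divisor of q - 1 and q + 1 divides their difference 2.
  not-both : ∀ r → ¬ (l ℕ.^ r ∣ 2) → l ℕ.^ r ∣ l ℕ.^ λ⁻ ℕ.* ω⁻ → ¬ (l ℕ.^ r ∣ l ℕ.^ λ⁺ ℕ.* ω⁺)
  not-both r l^r∤2 h⁻ h⁺ = l^r∤2 (∣m+n∣m⇒∣n
    (≡.subst (l ℕ.^ r ∣_) (≡.trans (≡.sym q+1≡) q+1≡q∸1+2) h⁺) (≡.subst (l ℕ.^ r ∣_) (≡.sym q∸1≡) h⁻))

  iter-T : ∀ j a → iter (T l) j a ≈ T (l ℕ.^ j) a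
  iter-T zero    a = refl
  iter-T (suc j) a = trans (T-cong l (iter-T j a)) (T-compose l (l ℕ.^ j) a)

  module _ (a : Carrier) where
    open Periods a

    private
      period-∸ : ∀ {m n} → n ≤ m → IsPeriod (+ m ℤ.- + n) → IsPeriod (+ (m ∸ n))
      period-∸ {m} {n} n≤m = period-≡ (≡.trans (ℤₚ.m-n≡m⊖n m n) (ℤₚ.⊖-≥ n≤m))

    order-period : IsPeriod (+ (q ∸ 1)) ⊎ IsPeriod (+ (q ℕ.+ 1))
    order-period = [ inj₂ , inj₁ ∘ period-∸ 1≤q ]′ (τ-≈⇒period (+ q) (+ 1) (T-q≈ a))

    -- Equality of T at l^(k+π) and l^k makes their sum or difference l^k (l^π ± 1) a period, and
    -- l^π ± 1 is coprime to l because π ≥ 1.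
    periodicAfter⇒coprime-period : ∀ {k} → PeriodicAfter l a k → ∃ λ c → Coprime l c × IsPeriod (+ (l ℕ.^ k ℕ.* c))
    periodicAfter⇒coprime-period {k} (suc π , _ , returns) =
      [ (λ p → l ℕ.^ suc π ℕ.+ 1 , (λ {d} → coprime-^+1 l π {d}) , period-≡ (≡.cong +_ factor-+) p)
      , (λ p → l ℕ.^ suc π ∸ 1 , (λ {d} → coprime-^∸1 l π {d}) , period-≡ (≡.cong +_ factor-∸) (period-∸ l^k≤ p))
      ]′ (τ-≈⇒period (+ (l ℕ.^ (k ℕ.+ suc π))) (+ (l ℕ.^ k))
          (trans (sym (iter-T (k ℕ.+ suc π) a)) (trans (≡⇒≈ returns) (iter-T k a))))
      where
      l^k≤ : l ℕ.^ k ≤ l ℕ.^ (k ℕ.+ suc π)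
      l^k≤ = ℕₚ.^-monoʳ-≤ l (ℕₚ.m≤m+n k (suc π))
      factor-+ : l ℕ.^ (k ℕ.+ suc π) ℕ.+ l ℕ.^ k ≡ l ℕ.^ k ℕ.* (l ℕ.^ suc π ℕ.+ 1)
      factor-+ = ≡.trans (≡.cong₂ ℕ._+_ (ℕₚ.^-distribˡ-+-* l k (suc π)) (≡.sym (ℕₚ.*-identityʳ (l ℕ.^ k))))
                         (≡.sym (ℕₚ.*-distribˡ-+ (l ℕ.^ k) (l ℕ.^ suc π) 1))
      factor-∸ : l ℕ.^ (k ℕ.+ suc π) ∸ l ℕ.^ k ≡ l ℕ.^ k ℕ.* (l ℕ.^ suc π ∸ 1)
      factor-∸ = ≡.trans (≡.cong₂ _∸_ (ℕₚ.^-distribˡ-+-* l k (suc π)) (≡.sym (ℕₚ.*-identityʳ (l ℕ.^ k))))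
                         (≡.sym (ℕₚ.*-distribˡ-∸ (l ℕ.^ k) (l ℕ.^ suc π) 1))

    -- The gcd of the period l^k c with the period q - 1 or q + 1 is again a period, and by `∣-^-⊓`
    -- it divides A_k or B_k.
    periodicAfter⇒period : ∀ {k} → PeriodicAfter l a k → IsPeriod (+ A⁻ k) ⊎ IsPeriod (+ A⁺ k)
    periodicAfter⇒period {k} periodic with c , l⊥c , p ← periodicAfter⇒coprime-period {k} periodic =
      Sum.map (reduce λ⁻ ω⁻ q∸1≡) (reduce λ⁺ ω⁺ q+1≡) order-period
      where
      reduce : ∀ s ω {x} → x ≡ l ℕ.^ s ℕ.* ω → IsPeriod (+ x) → IsPeriod (+ (l ℕ.^ (k ⊓ s) ℕ.* ω))
      reduce s ω {x} x≡ period-x = period-∣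
        (∣-^-⊓ l⊥c k s (gcd[m,n]∣m (l ℕ.^ k ℕ.* c) x)
          (≡.subst (gcd (l ℕ.^ k ℕ.* c) x ∣_) x≡ (gcd[m,n]∣n (l ℕ.^ k ℕ.* c) x)))
        (period-gcd p period-x)

    -- Choose π ≥ 1 with l^π ≡ 1 modulo ω. Then l^(k+π) - l^k = l^k (l^π - 1) is a multiple of the
    -- given period.
    period⇒periodicAfter : ∀ {k} → IsPeriod (+ A⁻ k) ⊎ IsPeriod (+ A⁺ k) → PeriodicAfter l a k
    period⇒periodicAfter {k} = [ returns λ⁻ ω⁻ l⊥ω⁻ 0<ω⁻
                               , returns λ⁺ ω⁺ l⊥ω⁺ 0<ω⁺ ]′
      where
      returns : ∀ s ω → Coprime l ω → 0 < ω → IsPeriod (+ (l ℕ.^ (k ⊓ s) ℕ.* ω)) → PeriodicAfter l a k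
      returns s ω l⊥ω 0<ω p with π , ω∣ ← coprime⇒∣^∸1 0<ω l⊥ω =
        suc π , s≤s z≤n , ≈⇒≡ (trans (iter-T (k ℕ.+ suc π) a) (trans shifted (sym (iter-T k a))))
        where
        d = l ℕ.^ k ℕ.* (l ℕ.^ suc π ∸ 1)
        ^-⊓-∣ : l ℕ.^ (k ⊓ s) ∣ l ℕ.^ k
        ^-⊓-∣ = ≡.subst (l ℕ.^ (k ⊓ s) ∣_)
          (≡.trans (≡.sym (ℕₚ.^-distribˡ-+-* l (k ⊓ s) (k ∸ k ⊓ s))) (≡.cong (l ℕ.^_) (ℕₚ.m+[n∸m]≡n (ℕₚ.m⊓n≤m k s))))
          (m∣m*n (l ℕ.^ (k ∸ k ⊓ s)))
        period-d : IsPeriod (+ d)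
        period-d = period-∣ (*-pres-∣ ^-⊓-∣ ω∣) p
        index : l ℕ.^ (k ℕ.+ suc π) ≡ l ℕ.^ k ℕ.+ d
        index = ≡.trans (ℕₚ.^-distribˡ-+-* l k (suc π))
          (≡.trans (≡.cong (l ℕ.^ k ℕ.*_) (≡.sym (ℕₚ.m+[n∸m]≡n (ℕₚ.m^n>0 l (suc π)))))
          (≡.trans (ℕₚ.*-distribˡ-+ (l ℕ.^ k) 1 _) (≡.cong (ℕ._+ d) (ℕₚ.*-identityʳ _))))
        shifted : T (l ℕ.^ (k ℕ.+ suc π)) a ≈ T (l ℕ.^ k) a
        shifted = trans (reflexive (≡.cong (λ n → T n a) index)) (period⇒τ-shift period-d (+ (l ℕ.^ k)))

    periodicAfter-suc : ∀ {k} → PeriodicAfter l a k → PeriodicAfter l a (suc k)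
    periodicAfter-suc (π , 1≤π , returns) = π , 1≤π , ≡.cong (T l) returns

    hasPreperiod-zero : PeriodicAfter l a 0 ⇔ HasPreperiod l a 0
    hasPreperiod-zero = mk⇔ (λ periodic → periodic , λ _ ()) proj₁

    -- Periodicity after j passes on to every larger index, so minimality has to be tested at k
    -- only.
    hasPreperiod-suc : ∀ k → HasPreperiod l a (suc k) ⇔ (PeriodicAfter l a (suc k) × ¬ PeriodicAfter l a k)
    hasPreperiod-suc k = mk⇔
      (λ (periodic , minimal) → periodic , minimal k ℕₚ.≤-refl)
      (λ (periodic , ¬periodic) → periodic , λ j j<1+k periodic-j →
        ¬periodic (descend-up (ℕₚ.≤-pred j<1+k) periodic-j))
      where
      descend-up : ∀ {j k} → j ≤ k → PeriodicAfter l a j → PeriodicAfter l a k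
      descend-up {j} {k} j≤k periodic with ℕₚ.m≤n⇒m<n∨m≡n j≤k
      ... | inj₂ ≡.refl = periodic
      descend-up {j} {suc k} _ periodic | inj₁ (s≤s j≤k) = periodicAfter-suc {k} (descend-up j≤k periodic)

  module _ (splits : ∀ k → Splits (A⁻ k) (A⁺ k)) where
    private
      difference : ℕ → Carrier → Carrier
      difference k a = τ a (Splits.i (splits k)) - τ a (Splits.j (splits k))

      difference≈0⇔periodicAfter : ∀ k a → difference k a ≈ 0# ⇔ PeriodicAfter l a k
      difference≈0⇔periodicAfter k a = mk⇔
        (λ zero → period⇒periodicAfter a {k} (Sum.map (period-≡ i+j≡A) (period-≡ i-j≡B)
                    (τ-≈⇒period i j (x-y≈0⇒x≈y zero))))
        (λ periodic → x≈y⇒x-y≈0 (period⇒τ-≈ i j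
                    (Sum.map (period-≡ (≡.sym i+j≡A)) (period-≡ (≡.sym i-j≡B)) (periodicAfter⇒period a {k} periodic))))
        where
        open Splits (splits k)
        open Periods a

      periodics : ℕ → List Carrier
      periodics k = zeros (difference k)

      ∈-periodics : ∀ k a → a ∈ periodics k ⇔ PeriodicAfter l a k
      ∈-periodics k a = mk⇔
        (λ a∈ → Equivalence.to (difference≈0⇔periodicAfter k a)
          (proj₂ (∈-filter⁻ (λ a → difference k a ≟ 0#) {xs = elements} a∈)))
        (λ periodic → ∈-filter⁺ (λ a → difference k a ≟ 0#) (∈-elements a)
          (Equivalence.from (difference≈0⇔periodicAfter k a) periodic))

      periodics-unique : ∀ k → Unique (periodics k)
      periodics-unique k = filter⁺ (λ a → difference k a ≟ 0#) elements-unique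

      2*length-periodics : ∀ k → 2 ℕ.* length (periodics k) ≡ A⁻ k ℕ.+ A⁺ k
      2*length-periodics k
        with n , i≡n , 2n≡ ← half-sum {i = Splits.i (splits k)} {Splits.j (splits k)}
               (Splits.i+j≡A (splits k)) (Splits.i-j≡B (splits k)) =
        ≡.trans (≡.cong (2 ℕ.*_) (≡.trans (Splits.length-zeros (splits k)) (≡.cong ∣_∣ i≡n))) 2n≡

    count-zero : Σ ℕ λ N → CountPreperiod l 0 N × 2 ℕ.* N ≡ ω⁻ ℕ.+ ω⁺
    count-zero = length (periodics 0) , (periodics 0 , periodics-unique 0 , membership , ≡.refl) ,
      ≡.trans (2*length-periodics 0) (≡.cong₂ ℕ._+_ (ℕₚ.*-identityˡ ω⁻) (ℕₚ.*-identityˡ ω⁺))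
      where
      membership : ∀ a → a ∈ periodics 0 ⇔ HasPreperiod l a 0
      membership a = mk⇔
        (λ a∈ → Equivalence.to (hasPreperiod-zero a) (Equivalence.to (∈-periodics 0 a) a∈))
        (λ preperiod → Equivalence.from (∈-periodics 0 a) (Equivalence.from (hasPreperiod-zero a) preperiod))

    -- Twice the number of elements of preperiod at most k is A_k + B_k, so D is twice the number of
    -- those that are new at level k + 1.
    count-suc : ∀ k {D} → A⁻ (suc k) ℕ.+ A⁺ (suc k) ≡ (A⁻ k ℕ.+ A⁺ k) ℕ.+ D →
                Σ ℕ λ N → CountPreperiod l (suc k) N × 2 ℕ.* N ≡ D
    count-suc k {D} increment = length new ,
      (new , filter⁺ old? (periodics-unique (suc k)) , (λ a → mk⇔
        (λ a∈ → let a∈′ , ¬zero = ∈-filter⁻ old? {xs = periodics (suc k)} a∈ in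
          Equivalence.from (hasPreperiod-suc a k)
            (Equivalence.to (∈-periodics (suc k) a) a∈′ , ¬zero ∘ Equivalence.from (difference≈0⇔periodicAfter k a)))
        (λ preperiod → let periodic , ¬periodic = Equivalence.to (hasPreperiod-suc a k) preperiod in
          ∈-filter⁺ old? (Equivalence.from (∈-periodics (suc k) a) periodic)
            (¬periodic ∘ Equivalence.to (difference≈0⇔periodicAfter k a)))) , ≡.refl) ,
      ℕₚ.+-cancelˡ-≡ (A⁻ k ℕ.+ A⁺ k) _ _ (begin
        (A⁻ k ℕ.+ A⁺ k) ℕ.+ 2 ℕ.* length new
          ≡⟨ ≡.cong (ℕ._+ 2 ℕ.* length new) (2*length-periodics k) ⟨
        2 ℕ.* length (periodics k) ℕ.+ 2 ℕ.* length new
          ≡⟨ ℕₚ.*-distribˡ-+ 2 (length (periodics k)) (length new) ⟨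
        2 ℕ.* (length (periodics k) ℕ.+ length new)          ≡⟨ ≡.cong (2 ℕ.*_) partition ⟨
        2 ℕ.* length (periodics (suc k))                     ≡⟨ 2*length-periodics (suc k) ⟩
        A⁻ (suc k) ℕ.+ A⁺ (suc k)                            ≡⟨ increment ⟩
        (A⁻ k ℕ.+ A⁺ k) ℕ.+ D                                ∎)
      where
      open ≡.≡-Reasoning
      old? : ∀ a → Dec (¬ difference k a ≈ 0#)
      old? a = ¬? (difference k a ≟ 0#)
      new = filter old? (periodics (suc k))
      partition : length (periodics (suc k)) ≡ length (periodics k) ℕ.+ length new
      partition = length-filter-∖ (λ a → difference (suc k) a ≟ 0#) (λ a → difference k a ≟ 0#)
        (λ a zero → Equivalence.from (difference≈0⇔periodicAfter (suc k) a)
          (periodicAfter-suc a {k} (Equivalence.to (difference≈0⇔periodicAfter k a) zero))) elements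

    -- The exponent r is 1 for odd l and 2 for l = 2. The two cases, according to which of q ± 1
    -- yields `ωm`, differ by exchanging the signs in `level-increment`.
    count-level : ∀ {ωm} r → ¬ (l ℕ.^ r ∣ 2) →
      (0 < λ⁻ ⊔ λ⁺ → (l ℕ.^ (λ⁻ ⊔ λ⁺) ℕ.* ωm ≡ q ∸ 1) ⊎ (l ℕ.^ (λ⁻ ⊔ λ⁺) ℕ.* ωm ≡ q ℕ.+ 1)) →
      ∀ k → r ≤ suc k → suc k ≤ λ⁻ ⊔ λ⁺ →
      Σ ℕ λ N → CountPreperiod l (suc k) N × 2 ℕ.* N ≡ (l ∸ 1) ℕ.* l ℕ.^ k ℕ.* ωm
    count-level {ωm} r l^r∤2 ωm-eq k r≤1+k 1+k≤λm with ωm-eq (ℕₚ.≤-trans (s≤s z≤n) 1+k≤λm)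
    ... | inj₁ eq = count-suc k
      (level-increment {l} {λ⁻} {ω⁻} {λ⁺} {ω⁺} {ωm} {r}
        (λ (h⁻ , h⁺) → not-both r l^r∤2 h⁻ h⁺) r≤1+k 1+k≤λm (≡.trans eq q∸1≡))
    ... | inj₂ eq = count-suc k (≡.trans (ℕₚ.+-comm (A⁻ (suc k)) _) (≡.trans
        (level-increment {l} {λ⁺} {ω⁺} {λ⁻} {ω⁻} {ωm} {r}
          (λ (h⁺ , h⁻) → not-both r l^r∤2 h⁻ h⁺) r≤1+k
          (≡.subst (suc k ≤_) (ℕₚ.⊔-comm λ⁻ λ⁺) 1+k≤λm)
          (≡.trans (≡.cong (λ m → l ℕ.^ m ℕ.* ωm) (ℕₚ.⊔-comm λ⁺ λ⁻)) (≡.trans eq q+1≡)))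
        (≡.cong (ℕ._+ (l ∸ 1) ℕ.* l ℕ.^ k ℕ.* ωm) (ℕₚ.+-comm (A⁺ k) (A⁻ k)))))

open import Data.Nat using (_+_; _*_; _^_)

-- Splitting at every level, for odd l and for l = 2

module PrimePreperiods
  {c e} (R : CommutativeRing c e) (p n : ℕ) (p-prime : Prime p) (1≤n : 1 ≤ n)
  (F : IsFiniteFieldOfOrder R (p ^ n))
  (l : ℕ) (l-prime : Prime l) (p≢l : ¬ p ≡ l) (λ⁻ ω⁻ λ⁺ ω⁺ : ℕ)
  (q∸1≡ : p ^ n ∸ 1 ≡ l ^ λ⁻ * ω⁻) (l⊥ω⁻ : Coprime l ω⁻)
  (q+1≡ : p ^ n + 1 ≡ l ^ λ⁺ * ω⁺) (l⊥ω⁺ : Coprime l ω⁺)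
  where

  private
    instance
      l≢0 : NonZero l
      l≢0 = prime⇒nonZero l-prime

    q = p ^ n

    T-q≈ : ∀ a → CommutativeRing._≈_ R (Chebyshev.T R q a) a
    T-q≈ = FiniteField.T-order R q F {n = n} p-prime ≡.refl

    1<p : 1 < p
    1<p = ℕ.nonTrivial⇒n>1 p {{prime⇒nonTrivial p-prime}}

    2≤q : 2 ≤ q
    2≤q = ℕₚ.≤-trans 1<p (ℕₚ.≤-trans (ℕₚ.≤-reflexive (≡.sym (ℕₚ.^-identityʳ p)))
      (ℕₚ.^-monoʳ-≤ p {{prime⇒nonZero p-prime}} 1≤n))

  open ChebyshevRoots R q F
  open Preperiods R q F T-q≈ 2≤q l λ⁻ ω⁻ λ⁺ ω⁺ q∸1≡ l⊥ω⁻ q+1≡ l⊥ω⁺ public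

  private
    splits-top : Splits (l ^ λ⁻ * ω⁻) (l ^ λ⁺ * ω⁺)
    splits-top = ≡.subst₂ Splits q∸1≡ q+1≡ (Splits-order 1≤q T-q≈)

    0<l^*ω⁻ : ∀ s → 0 < l ^ s * ω⁻
    0<l^*ω⁻ s = ℕₚ.*-mono-≤ (ℕₚ.m^n>0 l s) 0<ω⁻

    0<l^*ω⁺ : ∀ s → 0 < l ^ s * ω⁺
    0<l^*ω⁺ s = ℕₚ.*-mono-≤ (ℕₚ.m^n>0 l s) 0<ω⁺

    -- The given step lowers only the first argument of `Splits`. It is applied on the minus side
    -- with the plus side at its top, then on the plus side between two uses of `Splits-sym`.
    descend-both : ∀ {lo} →
      (∀ ω → (∀ s → 0 < l ^ s * ω) → ∀ k → lo ≤ k → ∀ {B} → 0 < B →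
        Splits (l ^ suc k * ω) B → Splits (l ^ k * ω) B) →
      ∀ {s t} → lo ≤ s → s ≤ λ⁻ → lo ≤ t → t ≤ λ⁺ → Splits (l ^ s * ω⁻) (l ^ t * ω⁺)
    descend-both step {s} {t} lo≤s s≤λ⁻ lo≤t t≤λ⁺ =
      Splits-sym (descend (λ t → Splits (l ^ t * ω⁺) (l ^ s * ω⁻))
        (λ k lo≤k → step ω⁺ 0<l^*ω⁺ k lo≤k (0<l^*ω⁻ s)) lo≤t t≤λ⁺ (Splits-sym
      (descend (λ s → Splits (l ^ s * ω⁻) (l ^ λ⁺ * ω⁺))
        (λ k lo≤k → step ω⁻ 0<l^*ω⁻ k lo≤k (0<l^*ω⁺ λ⁺)) lo≤s s≤λ⁻ splits-top)))

  splits-odd : ¬ l ≡ 2 → ∀ k → Splits (A⁻ k) (A⁺ k)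
  splits-odd l≢2 k with even⊎odd l
  ... | m , inj₁ l≡2m = contradiction
    (≡.sym (prime∣prime⇒≡ prime[2] l-prime (≡.subst (2 ∣_) (≡.sym l≡2m) (m∣m*n m)))) l≢2
  ... | m , inj₂ l≡1+2m = descend-both
    (λ ω 0<l^*ω k _ {B} 0<B s → Splits-odd m (0<l^*ω k) 0<B
      (≡.subst (λ A → Splits A B) (≡.trans (ℕₚ.*-assoc l (l ^ k) ω) (≡.cong (_* (l ^ k * ω)) l≡1+2m)) s))
    z≤n (ℕₚ.m⊓n≤n k λ⁻) z≤n (ℕₚ.m⊓n≤n k λ⁺)

  module _ (l≡2 : l ≡ 2) where
    private
      q-odd : ∀ m → ¬ q ≡ 2 * m
      q-odd m q≡2m = p≢l (≡.trans (≡.sym (prime∣prime⇒≡ prime[2] p-prime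
        (prime∣^⇒∣ prime[2] n (≡.subst (2 ∣_) (≡.sym q≡2m) (m∣m*n m))))) (≡.sym l≡2))

      coprime⇒odd : ∀ {ω} → Coprime l ω → ∃ λ m → ω ≡ suc (2 * m)
      coprime⇒odd {ω} l⊥ω with even⊎odd ω
      ... | m , inj₂ ω≡1+2m = m , ω≡1+2m
      ... | m , inj₁ ω≡2m = contradiction
        (l⊥ω (≡.subst (2 ∣_) (≡.sym l≡2) (divides 1 ≡.refl) , ≡.subst (2 ∣_) (≡.sym ω≡2m) (m∣m*n m))) λ ()

      m⁻ m⁺ : ℕ
      m⁻ = proj₁ (coprime⇒odd l⊥ω⁻)
      m⁺ = proj₁ (coprime⇒odd l⊥ω⁺)

      -- Otherwise q - 1 = ω⁻ would be odd and q even, although p ≠ 2. With `0<λ⁺` this keeps both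
      -- exponents positive at all levels from 1 on.
      0<λ⁻ : 0 < λ⁻
      0<λ⁻ with λ⁻ ℕ.≟ 0
      ... | no λ⁻≢0 = ℕₚ.n≢0⇒n>0 λ⁻≢0
      ... | yes λ⁻≡0 = contradiction (begin
        q                  ≡⟨ ℕₚ.m+[n∸m]≡n 1≤q ⟨
        suc (q ∸ 1)        ≡⟨ ≡.cong suc q∸1≡ ⟩
        suc (l ^ λ⁻ * ω⁻)  ≡⟨ ≡.cong₂ (λ s ω → suc (l ^ s * ω)) λ⁻≡0 (proj₂ (coprime⇒odd l⊥ω⁻)) ⟩
        suc (1 * suc (2 * m⁻)) ≡⟨ ≡.cong suc (ℕₚ.*-identityˡ (suc (2 * m⁻))) ⟩
        2 + 2 * m⁻         ≡⟨ ℕₚ.*-suc 2 m⁻ ⟨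
        2 * suc m⁻         ∎) (q-odd (suc m⁻))
        where open ≡.≡-Reasoning

      0<λ⁺ : 0 < λ⁺
      0<λ⁺ with λ⁺ ℕ.≟ 0
      ... | no λ⁺≢0 = ℕₚ.n≢0⇒n>0 λ⁺≢0
      ... | yes λ⁺≡0 = contradiction (ℕₚ.suc-injective (begin
        suc q              ≡⟨ ℕₚ.+-comm q 1 ⟨
        q + 1              ≡⟨ q+1≡ ⟩
        l ^ λ⁺ * ω⁺        ≡⟨ ≡.cong₂ (λ s ω → l ^ s * ω) λ⁺≡0 (proj₂ (coprime⇒odd l⊥ω⁺)) ⟩
        1 * suc (2 * m⁺)   ≡⟨ ℕₚ.*-identityˡ (suc (2 * m⁺)) ⟩
        suc (2 * m⁺)       ∎)) (q-odd m⁺)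
        where open ≡.≡-Reasoning

      l^suc*≡ : ∀ k ω → l ^ suc k * ω ≡ 2 * (l ^ k * ω)
      l^suc*≡ k ω = ≡.trans (ℕₚ.*-assoc l (l ^ k) ω) (≡.cong (_* (l ^ k * ω)) l≡2)

      -- `Splits-even` needs the number it reaches to be even, 2h with h = l^(k-1) ω; hence 1 ≤ k.
      step : ∀ ω → (∀ s → 0 < l ^ s * ω) → ∀ k → 1 ≤ k → ∀ {B} → 0 < B →
             Splits (l ^ suc k * ω) B → Splits (l ^ k * ω) B
      step ω 0<l^*ω (suc k) _ {B} 0<B s = ≡.subst (λ A → Splits A B) (≡.sym (l^suc*≡ k ω))
        (Splits-even (0<l^*ω k) 0<B
          (≡.subst (λ A → Splits A B) (≡.trans (l^suc*≡ (suc k) ω) (≡.cong (2 *_) (l^suc*≡ k ω))) s))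

      splits-positive : ∀ {s t} → 1 ≤ s → s ≤ λ⁻ → 1 ≤ t → t ≤ λ⁺ → Splits (l ^ s * ω⁻) (l ^ t * ω⁺)
      splits-positive = descend-both step

      splits-zero : Splits (l ^ 0 * ω⁻) (l ^ 0 * ω⁺)
      -- With ω⁻ = 2m⁻ + 1 and ω⁺ = 2m⁺ + 1, half of ω⁻ + ω⁺ is m⁻ + m⁺ + 1.
      splits-zero = Splits-halve {n = suc (m⁻ + m⁺)} (0<l^*ω⁻ 0) (0<l^*ω⁺ 0) (begin
        1 * ω⁻ + 1 * ω⁺                    ≡⟨ ≡.cong₂ _+_ (ℕₚ.*-identityˡ ω⁻) (ℕₚ.*-identityˡ ω⁺) ⟩
        ω⁻ + ω⁺
          ≡⟨ ≡.cong₂ _+_ (proj₂ (coprime⇒odd l⊥ω⁻)) (proj₂ (coprime⇒odd l⊥ω⁺)) ⟩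
        suc (2 * m⁻) + suc (2 * m⁺)        ≡⟨ ≡.cong suc (ℕₚ.+-suc (2 * m⁻) (2 * m⁺)) ⟩
        2 + (2 * m⁻ + 2 * m⁺)              ≡⟨ ≡.cong (λ x → 2 + x) (ℕₚ.*-distribˡ-+ 2 m⁻ m⁺) ⟨
        2 + 2 * (m⁻ + m⁺)                  ≡⟨ ℕₚ.*-suc 2 (m⁻ + m⁺) ⟨
        2 * suc (m⁻ + m⁺)                  ∎)
        (≡.subst₂ Splits (l^suc*≡ 0 ω⁻) (l^suc*≡ 0 ω⁺) (splits-positive ℕₚ.≤-refl 0<λ⁻ ℕₚ.≤-refl 0<λ⁺))
        where open ≡.≡-Reasoning

    splits-two : ∀ k → Splits (A⁻ k) (A⁺ k)
    splits-two zero = splits-zero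
    splits-two (suc k) = splits-positive (ℕₚ.⊓-glb (s≤s z≤n) 0<λ⁻) (ℕₚ.m⊓n≤n (suc k) λ⁻)
                                         (ℕₚ.⊓-glb (s≤s z≤n) 0<λ⁺) (ℕₚ.m⊓n≤n (suc k) λ⁺)

    -- From level 0 to level 1 both A_k and B_k double, so the increment is the sum at level 0. This
    -- is why preperiods 0 and 1 are equally frequent.
    increment-two : A⁻ 1 + A⁺ 1 ≡ (A⁻ 0 + A⁺ 0) + (ω⁻ + ω⁺)
    increment-two = begin
      l ^ (1 ⊓ λ⁻) * ω⁻ + l ^ (1 ⊓ λ⁺) * ω⁺
        ≡⟨ ≡.cong₂ (λ s t → l ^ s * ω⁻ + l ^ t * ω⁺) (ℕₚ.m≤n⇒m⊓n≡m 0<λ⁻) (ℕₚ.m≤n⇒m⊓n≡m 0<λ⁺) ⟩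
      l ^ 1 * ω⁻ + l ^ 1 * ω⁺                    ≡⟨ ≡.cong₂ _+_ (l^suc*≡ 0 ω⁻) (l^suc*≡ 0 ω⁺) ⟩
      2 * (1 * ω⁻) + 2 * (1 * ω⁺)                ≡⟨ ℕₚ.*-distribˡ-+ 2 (1 * ω⁻) (1 * ω⁺) ⟨
      2 * (1 * ω⁻ + 1 * ω⁺)
        ≡⟨ ≡.cong (λ x → (1 * ω⁻ + 1 * ω⁺) + x) (ℕₚ.+-identityʳ _) ⟩
      (1 * ω⁻ + 1 * ω⁺) + (1 * ω⁻ + 1 * ω⁺)
        ≡⟨ ≡.cong₂ (λ x y → (1 * ω⁻ + 1 * ω⁺) + (x + y)) (ℕₚ.*-identityˡ ω⁻) (ℕₚ.*-identityˡ ω⁺) ⟩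
      (1 * ω⁻ + 1 * ω⁺) + (ω⁻ + ω⁺)              ∎
      where open ≡.≡-Reasoning

-- The counts for odd l and for l = 2

theorem2p4 : ∀ {c e} (l p n : ℕ) → Prime l → Prime p → ¬ (p ≡ l) → 1 ≤ n →
    (R : CommutativeRing c e) → IsFiniteFieldOfOrder R (p ^ n) →
    (λ⁻ ω⁻ λ⁺ ω⁺ : ℕ) →
    p ^ n ∸ 1 ≡ l ^ λ⁻ * ω⁻ → Coprime l ω⁻ →
    p ^ n + 1 ≡ l ^ λ⁺ * ω⁺ → Coprime l ω⁺ →
    (ωm : ℕ) →
    (0 < λ⁻ ⊔ λ⁺ → (l ^ (λ⁻ ⊔ λ⁺) * ωm ≡ p ^ n ∸ 1) ⊎ (l ^ (λ⁻ ⊔ λ⁺) * ωm ≡ p ^ n + 1)) →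
    let open Chebyshev R in
    (¬ (l ≡ 2) →
    (Σ ℕ λ N → CountPreperiod l 0 N × 2 * N ≡ ω⁻ + ω⁺) ×
    (∀ k → 1 ≤ k → k ≤ λ⁻ ⊔ λ⁺ →
    Σ ℕ λ N → CountPreperiod l k N × 2 * N ≡ (l ∸ 1) * l ^ (k ∸ 1) * ωm))
    ×
    (l ≡ 2 →
    (Σ ℕ λ N → CountPreperiod l 0 N × 2 * N ≡ ω⁻ + ω⁺) ×
    (Σ ℕ λ N → CountPreperiod l 1 N × 2 * N ≡ ω⁻ + ω⁺) ×
    (∀ k → 2 ≤ k → k ≤ λ⁻ ⊔ λ⁺ → CountPreperiod l k (2 ^ (k ∸ 2) * ωm)))
theorem2p4 l p n l-prime p-prime p≢l 1≤n R F λ⁻ ω⁻ λ⁺ ω⁺ q∸1≡ l⊥ω⁻ q+1≡ l⊥ω⁺ ωm ωm-eq = odd , two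
  where
  open PrimePreperiods R p n p-prime 1≤n F l l-prime p≢l λ⁻ ω⁻ λ⁺ ω⁺ q∸1≡ l⊥ω⁻ q+1≡ l⊥ω⁺
  open ChebyshevRoots R (p ^ n) F using (Splits)
  open Chebyshev R using (CountPreperiod)

  odd : ¬ (l ≡ 2) →
    (Σ ℕ λ N → CountPreperiod l 0 N × 2 * N ≡ ω⁻ + ω⁺) ×
    (∀ k → 1 ≤ k → k ≤ λ⁻ ⊔ λ⁺ →
    Σ ℕ λ N → CountPreperiod l k N × 2 * N ≡ (l ∸ 1) * l ^ (k ∸ 1) * ωm)
  odd l≢2 = count-zero (splits-odd l≢2) , level
    where
    l∤2 : ¬ (l ^ 1 ∣ 2)
    l∤2 l∣2 = l≢2 (prime∣prime⇒≡ l-prime prime[2] (≡.subst (_∣ 2) (ℕₚ.^-identityʳ l) l∣2))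
    level : ∀ k → 1 ≤ k → k ≤ λ⁻ ⊔ λ⁺ →
            Σ ℕ λ N → CountPreperiod l k N × 2 * N ≡ (l ∸ 1) * l ^ (k ∸ 1) * ωm
    level (suc k) = count-level (splits-odd l≢2) 1 l∤2 ωm-eq k

  two : l ≡ 2 →
    (Σ ℕ λ N → CountPreperiod l 0 N × 2 * N ≡ ω⁻ + ω⁺) ×
    (Σ ℕ λ N → CountPreperiod l 1 N × 2 * N ≡ ω⁻ + ω⁺) ×
    (∀ k → 2 ≤ k → k ≤ λ⁻ ⊔ λ⁺ → CountPreperiod l k (2 ^ (k ∸ 2) * ωm))
  two l≡2 = count-zero splits , count-suc splits 0 (increment-two l≡2) , level
    where
    splits : ∀ k → Splits (A⁻ k) (A⁺ k)
    splits = splits-two l≡2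
    -- Both q - 1 and q + 1 are even, so the argument that only one side grows has to start from 4 =
    -- 2² instead of 2.
    l²∤2 : ¬ (l ^ 2 ∣ 2)
    l²∤2 l²∣2 with s≤s (s≤s ()) ← ∣⇒≤ (≡.subst (λ l → l ^ 2 ∣ 2) l≡2 l²∣2)
    -- For l = 2 the factor l - 1 is 1, and the doubled count contains a factor 2 that cancels,
    -- which gives the count itself.
    halve : ∀ k → (Σ ℕ λ N → CountPreperiod l (suc (suc k)) N × 2 * N ≡ (l ∸ 1) * l ^ suc k * ωm) →
            CountPreperiod l (suc (suc k)) (2 ^ k * ωm)
    halve k (N , count , 2N≡) = ≡.subst (CountPreperiod l (suc (suc k)))
      (ℕₚ.*-cancelˡ-≡ N (2 ^ k * ωm) 2 (begin
      2 * N                        ≡⟨ 2N≡ ⟩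
      (l ∸ 1) * l ^ suc k * ωm     ≡⟨ ≡.cong (λ l → (l ∸ 1) * l ^ suc k * ωm) l≡2 ⟩
      1 * 2 ^ suc k * ωm           ≡⟨ ≡.cong (_* ωm) (ℕₚ.*-identityˡ (2 ^ suc k)) ⟩
      2 * 2 ^ k * ωm               ≡⟨ ℕₚ.*-assoc 2 (2 ^ k) ωm ⟩
      2 * (2 ^ k * ωm)             ∎)) count
      where open ≡.≡-Reasoning
    level : ∀ k → 2 ≤ k → k ≤ λ⁻ ⊔ λ⁺ → CountPreperiod l k (2 ^ (k ∸ 2) * ωm)
    level (suc zero) (s≤s ())
    level (suc (suc k)) 2≤k k≤λm = halve k (count-level splits 2 l²∤2 ωm-eq (suc k) 2≤k k≤λm)
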